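{- Let $k \geq 2$, $p \geq 1$ and $q \geq 1$ be integers. Every $k$-connected graph $G$ of order $$n \geq \max\left\{6(k+p)+8(q-1)-2\left\lceil \frac{k-2}{k} \right\rceil,\ k(q+3)+\max\{(k-2)q-2,2p\}+2\max\{p,q\}-4\right\}$$ with $\delta(G) \geq \frac{n}{2}$ satisfies at least one of the following two properties: (i) for every spanning subgraph $H$ of $G$ with $\Delta(H) \leq p$, the graph $G-E(H)$ is $k$-connected; (ii) there are $q$ pairwise edge-disjoint Hamiltonian cycles $H_1,H_2,\ldots,H_q$ in $G$ such that $G-\bigcup_{1\leq i \leq q}E(H_i)$ is $k$-connected.
   Context: All graphs are finite, simple and undirected. $\delta(G)$ and $\Delta(G)$ denote the minimum and maximum degree. For $F \subseteq E(G)$, $G-F$ is the graph obtained from $G$ by deleting the edges in $F$ (keeping all vertices). A graph is $k$-connected if its vertex connectivity is at least $k$. -}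

module Defs where

open import Data.Nat using (ℕ; zero; suc; _+_; _*_; _∸_; _≤_; _<_; _⊔_)
open import Data.Nat.DivMod using (_/_)
open import Data.Bool using (Bool; true; false)
open import Data.Fin using (Fin; toℕ)
open import Data.Fin.Subset using (Subset; _∉_; ∣_∣)
open import Data.List using (length; filterᵇ)
open import Data.List.Base using () 
open import Data.Fin.Base using ()
open import Data.Product using (Σ; ∃; _×_; _,_)
open import Data.Sum using (_⊎_)
open import Relation.Nullary using (¬_)
open import Relation.Binary.PropositionalEquality using (_≡_; _≢_)
open import Function.Definitions using (Injective)
import Data.List as L
import Data.Fin as F

Graph : ℕ → Set
Graph n = Fin n → Fin n → Bool

record IsSimple {n : ℕ} (g : Graph n) : Set where
  field
    sym   : ∀ i j → g i j ≡ g j i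
    irrefl : ∀ i → g i i ≡ false

deg : {n : ℕ} → Graph n → Fin n → ℕ
deg {n} g i = length (filterᵇ (g i) (L.allFin n))

MinDegHalf : {n : ℕ} → Graph n → Set
MinDegHalf {n} g = ∀ v → n ≤ 2 * deg g v

MaxDegAtMost : {n : ℕ} → Graph n → ℕ → Set
MaxDegAtMost g p = ∀ v → deg g v ≤ p

data Walk {n : ℕ} (R : Fin n → Fin n → Set) (S : Subset n) : Fin n → Fin n → Set where
  here : ∀ {u} → Walk R S u u
  step : ∀ {u w v} → R u w → w ∉ S → Walk R S w v → Walk R S u v

KConnected : {n : ℕ} → ℕ → (Fin n → Fin n → Set) → Set
KConnected {n} k R =
  k < n × (∀ (S : Subset n) → ∣ S ∣ < k → ∀ u v → u ∉ S → v ∉ S → Walk R S u v)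

Edge : {n : ℕ} → Graph n → Fin n → Fin n → Set
Edge g i j = g i j ≡ true

record SpanningSubgraph {n : ℕ} (g h : Graph n) : Set where
  field
    simple : IsSimple h
    sub    : ∀ i j → h i j ≡ true → g i j ≡ true

minusEdges : {n : ℕ} → Graph n → Graph n → Fin n → Fin n → Set
minusEdges g h i j = g i j ≡ true × h i j ≡ false

Next : {n : ℕ} → Fin n → Fin n → Set
Next {n} i j = suc (toℕ i) ≡ toℕ j ⊎ (suc (toℕ i) ≡ n × toℕ j ≡ 0)

record HamCycle {n : ℕ} (g : Graph n) : Set where
  field
    order : 3 ≤ n
    c     : Fin n → Fin n
    inj   : Injective _≡_ _≡_ c
    adj   : ∀ i j → Next i j → g (c i) (c j) ≡ true

InCycle : {n : ℕ} {g : Graph n} → HamCycle g → Fin n → Fin n → Set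
InCycle C x y = ∃ λ i → ∃ λ j → Next i j ×
  ((HamCycle.c C i ≡ x × HamCycle.c C j ≡ y) ⊎ (HamCycle.c C i ≡ y × HamCycle.c C j ≡ x))

minusCycles : {n q : ℕ} {g : Graph n} → (Fin q → HamCycle g) → Fin n → Fin n → Set
minusCycles {g = g} C x y = g x y ≡ true × (∀ a → ¬ InCycle (C a) x y)

ceilDivSuc : ℕ → ℕ → ℕ
ceilDivSuc a b = (a + b) / suc b

-- the lower bound on n; all subtractions are non-truncating under k ≥ 2, p,q ≥ 1
-- (for the inner max, if (k-2)q-2 < 0 the max is 2p anyway). ⌈(k-2)/k⌉ for k = suc k'.
bound : ℕ → ℕ → ℕ → ℕ
bound zero p q = 0
bound (suc k') p q =
  let k = suc k' in
  (6 * (k + p) + 8 * (q ∸ 1) ∸ 2 * ceilDivSuc (k ∸ 2) k')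
  ⊔ (k * (q + 3) + (((k ∸ 2) * q ∸ 2) ⊔ (2 * p)) + 2 * (p ⊔ q) ∸ 4)

-- If deleting some H destroys k-connectivity, then V splits into A, S, B with |S| < k and at most p
-- neighbours across A|B for every vertex, so by the degree condition A and B are almost cliques on about n/2
-- vertices.  Put each vertex of S on the side where it has more neighbours.  Since G is k-connected, no k - 1
-- vertices cover the edges between the two sides, so by Kőnig's theorem there are k disjoint such edges; the
-- Hamiltonian cycles will avoid them.  The degree condition also gives, for each vertex v, many
-- crossing edges missing v, hence q times two disjoint unused ones.  Each such pair is
-- closed to a Hamiltonian cycle by a Hamiltonian path on either side, found by 2-opt moves.
-- What remains is still dense inside each side, and the k reserved edges join the sides.
module Submission where

open import Defs
open import Data.Bool using (Bool; true; false; _∧_; _∨_; not; if_then_else_)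
open import Data.Bool.Properties using (∨-comm; ∧-comm; not-involutive; ¬-not; T-≡) renaming (_≟_ to _≟ᵇ_)
open import Data.Empty using (⊥)
open import Data.Fin using (Fin; zero; suc; toℕ; cast)
open import Data.Fin.Properties using (_≟_; any?; all?; toℕ-cast; toℕ-injective; toℕ<n)
import Data.Fin.Subset as Subset
open import Data.Fin.Subset using (Subset; ∣_∣)
open import Data.Fin.Subset.Properties using (anySubset?)
open import Data.List using (List; []; _∷_; _++_; [_]; length; filterᵇ; allFin; tabulate; map; reverse; cartesianProduct) renaming (lookup to lookupᴸ)
open import Data.List.Membership.DecPropositional using () renaming (_∈?_ to member?)
open import Data.List.Membership.Propositional using (_∈_; _∉_)
open import Data.List.Membership.Propositional.Properties using (∈-∃++; ∈-allFin; ∈-++⁻; ∈-++⁺ˡ; ∈-++⁺ʳ; ∈-filter⁺; ∈-filter⁻; ∈-lookup; ∈-map⁺; ∈-cartesianProduct⁺)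
open import Data.List.Properties using (++-assoc; length-++; length-map; length-tabulate; unfold-reverse)
open import Data.List.Relation.Binary.Permutation.Propositional using (_↭_; prep; swap; ↭-refl; ↭-trans; ↭-sym; ↭-reflexive; ↭⇒↭ₛ)
open import Data.List.Relation.Binary.Permutation.Propositional.Properties using (shift; ++⁺; ++⁺ˡ; ++⁺ʳ; ↭-length; ∈-resp-↭; ↭-reverse; ++-comm)
import Data.List.Relation.Binary.Permutation.Setoid.Properties as SetoidPerm
open import Data.List.Relation.Unary.All as All using (All; []; _∷_)
open import Data.List.Relation.Unary.AllPairs using ([]; _∷_)
open import Data.List.Relation.Unary.Any using (here; there)
open import Data.List.Relation.Unary.Unique.Propositional using (Unique)
open import Data.List.Relation.Unary.Unique.Propositional.Properties using (allFin⁺)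
open import Data.Nat using (ℕ; zero; suc; _+_; _*_; _≤_; _<_; z≤n; s≤s; s≤s⁻¹)
open import Data.Nat.DivMod using (m<n*o⇒m/o<n)
import Data.Nat.Properties as ℕ
open import Data.Nat.Properties hiding (_≟_)
open import Data.Nat.Tactic.RingSolver using (solve-∀)
open import Data.Product using (Σ; ∃; ∃₂; _×_; _,_; proj₁; proj₂) renaming (swap to ×-swap)
open import Data.Sum using (_⊎_; inj₁; inj₂; [_,_]′) renaming (swap to ⊎-swap)
open import Data.Unit using (⊤; tt)
open import Data.Vec using ([]; _∷_; lookup) renaming (tabulate to vtabulate)
open import Data.Vec.Properties using (lookup∘tabulate; lookup⇒[]=; []=⇒lookup)
open import Function using (_∘_; id; flip)
open import Function.Bundles using (Equivalence)
open import Relation.Binary using (Tri; tri<; tri≈; tri>)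
open import Relation.Binary.PropositionalEquality hiding ([_]; J)
open import Relation.Nullary using (Dec; yes; no; does; ¬_; contradiction)
open import Relation.Nullary.Decidable using (T?; dec-true; dec-false; _×-dec_; _⊎-dec_; _→-dec_; toSum)

-- Crossing edges are the scarce resource, so both the reserved edges and the cycles are kept small
-- across the cut. The reserved edges form an edge-minimal graph without a cover of fewer than k
-- vertices; such a graph touches at most 2k vertices. Each cycle may cross only between four chosen
-- vertices. After i cycles, a list of at most 2k + 4i vertices therefore contains both ends of
-- every blocked crossing edge, and a vertex outside the list still has all of its crossing edges.
--
-- Inside a side the obstacle is the vertices that came from S. They are sure of only about n/4
-- neighbours there, so two of them may fail every degree-sum condition; the 2-opt moves therefore
-- deal with the kinds of missing edges one after another.
--
-- The violating H itself is not searched for. It is replaced by the cut that it leaves in G, whose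
-- existence is decidable, and this decides which of the two properties is proved.

private variable
  A : Set
  n k b b′ : ℕ
  u v w x y z : A
  p q : List A

-- Linear inequalities are proved from a combination l ≤ r of the hypotheses, up to a semiring identity.
lin : ∀ {a b l r : ℕ} (c : ℕ) → l ≤ r → a + r + c ≡ b + l → a ≤ b
lin {a} {b} {l} {r} c l≤r eq = +-cancelʳ-≤ r a b (begin
  a + r      ≤⟨ m≤m+n (a + r) c ⟩
  a + r + c  ≡⟨ eq ⟩
  b + l      ≤⟨ +-monoʳ-≤ b l≤r ⟩
  b + r      ∎)
  where open ≤-Reasoning

-- Boolean predicates and counting

holds : {P : Set} (d : Dec P) → does d ≡ true → P
holds (yes p) _ = p

fails : {P : Set} (d : Dec P) → does d ≡ false → ¬ P
fails (no ¬p) _ = ¬p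

∧⁻ : ∀ {a b} → a ∧ b ≡ true → a ≡ true × b ≡ true
∧⁻ {true} {true} _ = refl , refl

∧⁺ : ∀ {a b} → a ≡ true → b ≡ true → a ∧ b ≡ true
∧⁺ refl refl = refl

∨⁻ : ∀ {a b} → a ∨ b ≡ true → a ≡ true ⊎ b ≡ true
∨⁻ {true}  _ = inj₁ refl
∨⁻ {false} p = inj₂ p

∨⁺ˡ : ∀ {a b} → a ≡ true → a ∨ b ≡ true
∨⁺ˡ refl = refl

∨⁺ʳ : ∀ {a b} → b ≡ true → a ∨ b ≡ true
∨⁺ʳ {true}  _ = refl
∨⁺ʳ {false} p = p

not⁻ : ∀ {a} → not a ≡ true → a ≡ false
not⁻ {false} _ = refl

not⁺ : ∀ {a} → a ≡ false → not a ≡ true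
not⁺ refl = refl

clashᵇ : ∀ {a} → a ≡ true → a ≡ false → ∀ {P : Set} → P
clashᵇ refl ()

ι : Bool → ℕ
ι true  = 1
ι false = 0

ι≤1 : ∀ a → ι a ≤ 1
ι≤1 true  = ≤-refl
ι≤1 false = z≤n

sumOn : (A → ℕ) → List A → ℕ
sumOn h []       = 0
sumOn h (x ∷ xs) = h x + sumOn h xs

cnt : (A → Bool) → List A → ℕ
cnt f = sumOn (ι ∘ f)

# : (Fin n → Bool) → ℕ
# {n} f = cnt f (allFin n)

ι-mono : ∀ {a b} → (a ≡ true → b ≡ true) → ι a ≤ ι b
ι-mono {false} _ = z≤n
ι-mono {true} {b} h rewrite h refl = ≤-refl

sumOn-mono : {h k : A → ℕ} → (∀ x → h x ≤ k x) → ∀ xs → sumOn h xs ≤ sumOn k xs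
sumOn-mono h≤k []       = z≤n
sumOn-mono h≤k (x ∷ xs) = +-mono-≤ (h≤k x) (sumOn-mono h≤k xs)

sumOn-+ : (h k : A → ℕ) → ∀ xs → sumOn (λ x → h x + k x) xs ≡ sumOn h xs + sumOn k xs
sumOn-+ h k []       = refl
sumOn-+ h k (x ∷ xs) rewrite sumOn-+ h k xs = interchange (h x) (k x) (sumOn h xs) (sumOn k xs)
  where
  interchange : ∀ a b c d → a + b + (c + d) ≡ a + c + (b + d)
  interchange = solve-∀

sumOn-↭ : (h : A → ℕ) → ∀ {xs ys} → xs ↭ ys → sumOn h xs ≡ sumOn h ys
sumOn-↭ h _↭_.refl = refl
sumOn-↭ h (prep x p) = cong (h x +_) (sumOn-↭ h p)
sumOn-↭ h {ys = _ ∷ _ ∷ ys} (swap x y p) rewrite sumOn-↭ h p = exchange (h x) (h y) (sumOn h ys)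
  where
  exchange : ∀ a b c → a + (b + c) ≡ b + (a + c)
  exchange = solve-∀
sumOn-↭ h (_↭_.trans p q) = trans (sumOn-↭ h p) (sumOn-↭ h q)

sumOn-++ : (h : A → ℕ) → ∀ xs ys → sumOn h (xs ++ ys) ≡ sumOn h xs + sumOn h ys
sumOn-++ h []       ys = refl
sumOn-++ h (x ∷ xs) ys rewrite sumOn-++ h xs ys = sym (+-assoc (h x) _ _)

cnt-⊆ : {f g : A → Bool} → (∀ x → f x ≡ true → g x ≡ true) → ∀ xs → cnt f xs ≤ cnt g xs
cnt-⊆ f⊆g = sumOn-mono (λ x → ι-mono (f⊆g x))

cnt-filter : (f s : A → Bool) → ∀ xs → cnt f (filterᵇ s xs) ≡ cnt (λ x → f x ∧ s x) xs
cnt-filter f s [] = refl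
cnt-filter f s (x ∷ xs) with f x in eq | s x
... | true  | true rewrite eq  = cong suc (cnt-filter f s xs)
... | false | true rewrite eq  = cnt-filter f s xs
... | true  | false = cnt-filter f s xs
... | false | false = cnt-filter f s xs

length-filterᵇ : (f : A → Bool) → ∀ xs → length (filterᵇ f xs) ≡ cnt f xs
length-filterᵇ f [] = refl
length-filterᵇ f (x ∷ xs) with f x
... | true  = cong suc (length-filterᵇ f xs)
... | false = length-filterᵇ f xs

cnt-true : (xs : List A) → cnt (λ _ → true) xs ≡ length xs
cnt-true []       = refl
cnt-true (x ∷ xs) = cong suc (cnt-true xs)

#-⊆ : {f g : Fin n → Bool} → (∀ x → f x ≡ true → g x ≡ true) → # f ≤ # g
#-⊆ f⊆g = cnt-⊆ f⊆g (allFin _)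

#-true : ∀ n → # {n} (λ _ → true) ≡ n
#-true n = trans (cnt-true (allFin n)) (length-tabulate id)

#-mono₂ : {f g h k : Fin n → Bool} →
  (∀ x → ι (f x) + ι (g x) ≤ ι (h x) + ι (k x)) → # f + # g ≤ # h + # k
#-mono₂ {n} {f} {g} {h} {k} le = subst₂ _≤_ (sumOn-+ (ι ∘ f) (ι ∘ g) (allFin n)) (sumOn-+ (ι ∘ h) (ι ∘ k) (allFin n))
  (sumOn-mono le (allFin n))

#-split : (f s : Fin n → Bool) → # f ≡ # (λ x → f x ∧ s x) + # (λ x → f x ∧ not (s x))
#-split {n} f s = ≤-antisym
  (≤-trans (sumOn-mono (λ x → ≤-reflexive (eq (f x) (s x))) (allFin n)) (≤-reflexive (sumOn-+ _ _ (allFin n))))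
  (≤-trans (≤-reflexive (sym (sumOn-+ _ _ (allFin n)))) (sumOn-mono (λ x → ≤-reflexive (sym (eq (f x) (s x)))) (allFin n)))
  where
  eq : ∀ a b → ι a ≡ ι (a ∧ b) + ι (a ∧ not b)
  eq false _    = refl
  eq true true  = refl
  eq true false = refl

#-incl-excl : (f g : Fin n → Bool) → # f + # g ≤ # (λ x → f x ∨ g x) + # (λ x → f x ∧ g x)
#-incl-excl f g = #-mono₂ (λ x → eq (f x) (g x))
  where
  eq : ∀ a b → ι a + ι b ≤ ι (a ∨ b) + ι (a ∧ b)
  eq false false = ≤-refl
  eq true true   = ≤-refl
  eq true false  = ≤-refl
  eq false true  = ≤-refl

#-∨ : (f g : Fin n → Bool) → # (λ x → f x ∨ g x) ≤ # f + # g
#-∨ {n} f g = ≤-trans (sumOn-mono (λ x → le (f x) (g x)) (allFin n)) (≤-reflexive (sumOn-+ _ _ (allFin n)))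
  where
  le : ∀ a b → ι (a ∨ b) ≤ ι a + ι b
  le false b = ≤-refl
  le true b  = s≤s z≤n

_=ᵇ_ : Fin n → Fin n → Bool
x =ᵇ y = does (x ≟ y)

mem : List (Fin n) → Fin n → Bool
mem T v = does (member? _≟_ v T)

cnt-fresh : ∀ (t : Fin n) xs → All (t ≢_) xs → cnt (t =ᵇ_) xs ≡ 0
cnt-fresh t [] [] = refl
cnt-fresh t (x ∷ xs) (t≢x ∷ ps) rewrite dec-false (t ≟ x) t≢x = cnt-fresh t xs ps

cnt-single : ∀ (t : Fin n) {xs} → Unique xs → cnt (t =ᵇ_) xs ≤ 1
cnt-single t [] = z≤n
cnt-single t {x ∷ xs} (x∉ ∷ u) with t ≟ x
... | yes refl = s≤s (≤-reflexive (cnt-fresh t xs x∉))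
... | no _     = cnt-single t u

#-single : (t : Fin n) → # (t =ᵇ_) ≤ 1
#-single {n} t = cnt-single t (allFin⁺ n)

#-none : {f : Fin n → Bool} → (∀ x → f x ≡ false) → # f ≡ 0
#-none {n} {f} h = go (allFin n)
  where
  go : ∀ xs → cnt f xs ≡ 0
  go [] = refl
  go (x ∷ xs) rewrite h x = go xs

#-list : (f : Fin n → Bool) (T : List (Fin n)) → (∀ x → f x ≡ true → x ∈ T) → # f ≤ length T
#-list f [] h = ≤-reflexive (#-none (λ x → ¬-not λ fx → contradiction (h x fx) λ ()))
#-list f (t ∷ T) h = begin
  # f                                              ≤⟨ #-⊆ sub ⟩
  # (λ x → (t =ᵇ x) ∨ (f x ∧ not (t =ᵇ x)))         ≤⟨ #-∨ (t =ᵇ_) _ ⟩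
  # (t =ᵇ_) + # (λ x → f x ∧ not (t =ᵇ x))          ≤⟨ +-mono-≤ (#-single t) (#-list _ T rest) ⟩
  suc (length T)                                   ∎
  where
  open ≤-Reasoning
  sub : ∀ x → f x ≡ true → (t =ᵇ x) ∨ (f x ∧ not (t =ᵇ x)) ≡ true
  sub x fx with t =ᵇ x
  ... | true  = refl
  ... | false rewrite fx = refl
  rest : ∀ x → f x ∧ not (t =ᵇ x) ≡ true → x ∈ T
  rest x p with ∧⁻ p
  ... | fx , ne with h x fx
  ...   | there x∈T = x∈T
  ...   | here refl = contradiction refl (fails (t ≟ t) (not⁻ ne))

#-mem : (T : List (Fin n)) → # (mem T) ≤ length T
#-mem T = #-list (mem T) T (λ x → holds (member? _≟_ x T))

#-witness : {P Q : Fin n → Bool} → # Q < # P → ∃ λ v → P v ≡ true × Q v ≡ false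
#-witness {n} {P} {Q} lt with any? (λ v → (P v ≟ᵇ true) ×-dec (Q v ≟ᵇ false))
... | yes w = w
... | no ¬w = contradiction lt (≤⇒≯ (#-⊆ sub))
  where
  sub : ∀ x → P x ≡ true → Q x ≡ true
  sub x px with Q x in eq
  ... | true  = refl
  ... | false = contradiction (x , px , eq) ¬w

#-avoid : {P : Fin n → Bool} (T : List (Fin n)) → length T < # P → ∃ λ v → P v ≡ true × v ∉ T
#-avoid T lt with #-witness (≤-<-trans (#-mem T) lt)
... | v , pv , q = v , pv , fails (member? _≟_ v T) q

sumOn-tabulate : ∀ {m} (h : A → ℕ) (φ : Fin m → A) → sumOn h (tabulate φ) ≡ sumOn (h ∘ φ) (allFin m)
sumOn-tabulate {m = zero}  h φ = refl
sumOn-tabulate {m = suc m} h φ = cong (h (φ zero) +_)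
  (trans (sumOn-tabulate h (φ ∘ suc)) (sym (sumOn-tabulate (h ∘ φ) suc)))

∣∣≡# : (S : Subset n) → ∣ S ∣ ≡ # (lookup S)
∣∣≡# [] = refl
∣∣≡# (true ∷ S)  = cong suc (trans (∣∣≡# S) (sym (sumOn-tabulate (ι ∘ lookup (true ∷ S)) suc)))
∣∣≡# (false ∷ S) = trans (∣∣≡# S) (sym (sumOn-tabulate (ι ∘ lookup (false ∷ S)) suc))

-- Paths and 2-opt moves

Rel : Set → Set₁
Rel A = A → A → Set

-- The number counts the bad steps and `D` says what is known about them. Density is then demanded
-- only for pairs of the kind `D`, and a path with count 0 is a path of `E` alone.
data Path {A : Set} (E D : Rel A) : ℕ → A → A → List A → Set where
  end  : Path E D 0 x x (x ∷ [])
  good : E x y → Path E D b y z p → Path E D b x z (x ∷ p)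
  bad  : D x y → Path E D b y z p → Path E D (suc b) x z (x ∷ p)

module _ {E D : Rel A} where

  join-good : Path E D b x y p → E y z → Path E D b′ z w q → Path E D (b + b′) x w (p ++ q)
  join-good end        e Q = good e Q
  join-good (good f P) e Q = good f (join-good P e Q)
  join-good (bad f P)  e Q = bad f (join-good P e Q)

  join-bad : Path E D b x y p → D y z → Path E D b′ z w q → Path E D (suc (b + b′)) x w (p ++ q)
  join-bad end        d Q = bad d Q
  join-bad (good f P) d Q = good f (join-bad P d Q)
  join-bad (bad f P)  d Q = bad f (join-bad P d Q)

  module _ (symE : ∀ {x y} → E x y → E y x) (symD : ∀ {x y} → D x y → D y x) where

    reversePath : Path E D b x y p → Path E D b y x (reverse p)
    reversePath end = end
    reversePath {x = x} {y = y} (good {p = p} e P) rewrite unfold-reverse x p =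
      subst (λ b → Path E D b y x (reverse p ++ x ∷ [])) (+-identityʳ _) (join-good (reversePath P) (symE e) end)
    reversePath {x = x} {y = y} (bad {p = p} d P) rewrite unfold-reverse x p =
      subst (λ b → Path E D b y x (reverse p ++ x ∷ [])) (cong suc (+-identityʳ _)) (join-bad (reversePath P) (symD d) end)

  record BadStep (b : ℕ) (x y : A) (p : List A) : Set where
    constructor badStep
    field
      {b₁ b₂}  : ℕ
      {s t}    : A
      {l r}    : List A
      before   : Path E D b₁ x s l
      badEdge  : D s t
      after    : Path E D b₂ t y r
      splits   : p ≡ l ++ r
      counts   : b ≡ b₁ + b₂

  findBad : Path E D (suc b) x y p → BadStep b x y p
  findBad (good e P) with badStep L d R refl refl ← findBad P = badStep (good e L) d R refl refl
  findBad {b = zero}  (bad d P) = badStep end d P refl refl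
  findBad {b = suc b} (bad d P) = badStep end d P refl refl

  record Cut (f g : A → Bool) (b : ℕ) (x y : A) (p : List A) : Set where
    constructor cut
    field
      {b₁ b₂} : ℕ
      {s t}   : A
      {l r}   : List A
      before  : Path E D b₁ x s l
      f-end   : f s ≡ true
      g-start : g t ≡ true
      after   : Path E D b₂ t y r
      splits  : p ≡ l ++ r
      counts  : b₁ + b₂ ≤ b

  private
    cut-step : ∀ {a a' b b' : ℕ} l → a + b ≤ l + b' → a' + b' ≤ 1 → ∀ {h} → a' + a + (h + b) ≤ suc l + h
    cut-step {a} {a'} {b} {b'} l le le' {h} = lin 0 (+-mono-≤ le le') (arith a a' b b' h l)
      where
      arith : ∀ a a' b b' h l → a' + a + (h + b) + (l + b' + 1) + 0 ≡ 1 + l + h + (a + b + (a' + b'))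
      arith = solve-∀

  -- Pigeonhole on consecutive pairs: no step from f to g forces f and g to be sparse on p.
  findCut : (f g : A → Bool) → Path E D b x y p →
    Cut f g b x y p ⊎ (cnt f p + cnt g p ≤ length p + ι (g x))
  findCut {x = x} f g end with f x | g x
  ... | false | _     = inj₂ (≤-trans (≤-reflexive (+-identityʳ _)) (m≤n+m _ 1))
  ... | true  | false = inj₂ ≤-refl
  ... | true  | true  = inj₂ ≤-refl
  findCut {x = x} f g (good {y = y} {p = p} e P) with f x in fx | g y in gy | findCut f g P
  ... | true  | true  | _ = inj₁ (cut end fx gy P refl ≤-refl)
  ... | _     | _     | inj₁ (cut L a b R refl le) = inj₁ (cut (good e L) a b R refl le)
  ... | true  | false | inj₂ le = inj₂ (cut-step {a = cnt f p} {1} {cnt g p} {0} (length p) le ≤-refl)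
  ... | false | gy'   | inj₂ le = inj₂ (cut-step {a = cnt f p} {0} {cnt g p} {ι gy'} (length p) le (ι≤1 gy'))
  findCut {x = x} f g (bad {y = y} {p = p} e P) with f x in fx | g y in gy | findCut f g P
  ... | true  | true  | _ = inj₁ (cut end fx gy P refl (n≤1+n _))
  ... | _     | _     | inj₁ (cut L a b R refl le) = inj₁ (cut (bad e L) a b R refl (s≤s le))
  ... | true  | false | inj₂ le = inj₂ (cut-step {a = cnt f p} {1} {cnt g p} {0} (length p) le ≤-refl)
  ... | false | gy'   | inj₂ le = inj₂ (cut-step {a = cnt f p} {0} {cnt g p} {ι gy'} (length p) le (ι≤1 gy'))

_⇒ᵇ : (A → A → Bool) → Rel A
(e ⇒ᵇ) x y = e x y ≡ true

module TwoOpt (e : A → A → Bool) (sym-e : ∀ x y → e x y ≡ true → e y x ≡ true)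
  (D : Rel A) (sym-D : ∀ {x y} → D x y → D y x) (L : List A)
  (dense : ∀ {u v} → D u v → length L + 3 ≤ cnt (e u) L + cnt (e v) L) where

  P : ℕ → A → A → List A → Set
  P = Path (e ⇒ᵇ) D

  private
    rev : P b x y p → P b y x (reverse p)
    rev = reversePath (λ {x} {y} → sym-e x y) sym-D

    -- If neither part of the path has a usable step, each contributes at most its length plus one
    -- for its first vertex. The two counts then sum to at most `length L + 2`, which explains the 3
    -- in `dense`.
    contra : ∀ {l r} {f g : A → Bool} {a c} → l ++ r ↭ L →
      length L + 3 ≤ cnt f L + cnt g L →
      cnt f l + cnt g l ≤ length l + ι (g a) →
      cnt f r + cnt g r ≤ length r + ι (g c) → ∀ {X : Set} → X
    contra {l} {r} {f} {g} {a} {c} pm hd h1 h2 = contradiction bound' (λ ())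
      where
      eqf : cnt f L ≡ cnt f l + cnt f r
      eqf = trans (sumOn-↭ _ (↭-sym pm)) (sumOn-++ _ l r)
      eqg : cnt g L ≡ cnt g l + cnt g r
      eqg = trans (sumOn-↭ _ (↭-sym pm)) (sumOn-++ _ l r)
      eql : length L ≡ length l + length r
      eql = trans (↭-length (↭-sym pm)) (length-++ l)
      hd' : length l + length r + 3 ≤ cnt f l + cnt f r + (cnt g l + cnt g r)
      hd' = subst₂ _≤_ (cong (_+ 3) eql) (cong₂ _+_ eqf eqg) hd
      bound' : 1 ≤ 0
      bound' = lin 0 (+-mono-≤ hd' (+-mono-≤ h1 (+-mono-≤ h2 (+-mono-≤ (ι≤1 (g a)) (ι≤1 (g c))))))
        (arith (cnt f l) (cnt f r) (cnt g l) (cnt g r) (length l) (length r) (ι (g a)) (ι (g c)))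
        where
        arith : ∀ A B C D a b i j →
          1 + (A + B + (C + D) + (a + i + (b + j + 2))) + 0 ≡ 0 + (a + b + 3 + (A + C + (B + D + (i + j))))
        arith = solve-∀

  -- A bad step uv is removed by reversing a segment, at a step ww' with u ~ w and v ~ w'.
  improve : P (suc b) x y p → p ↭ L → ∃₂ λ b' p' → b' ≤ b × P b' x y p' × p' ↭ L
  improve Q pm with findBad Q
  ... | badStep {b₁} {b₂} {u} {v} {l} {r} left d right refl refl
    with findCut (e u) (e v) left | findCut (e u) (e v) right
  ...   | inj₁ (cut {c₁} {c₂} {l = l₁} {r = l₂} L₁ uw vw' L₂ refl le) | _ =
    _ , l₁ ++ (reverse l₂ ++ r)
    , ≤-trans (≤-reflexive (sym (+-assoc c₁ c₂ b₂))) (+-monoˡ-≤ b₂ le)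
    , join-good L₁ (sym-e _ _ uw) (join-good (rev L₂) (sym-e _ _ vw') right)
    , ↭-trans (↭-trans (++⁺ˡ l₁ (++⁺ʳ r (↭-reverse l₂))) (↭-reflexive (sym (++-assoc l₁ l₂ r)))) pm
  ...   | inj₂ _ | inj₁ (cut {c₁} {c₂} {l = r₁} {r = r₂} R₁ uw vw' R₂ refl le) =
    _ , l ++ (reverse r₁ ++ r₂)
    , +-monoʳ-≤ b₁ le
    , join-good left uw (join-good (rev R₁) vw' R₂)
    , ↭-trans (++⁺ˡ l (++⁺ʳ r₂ (↭-reverse r₁))) pm
  ...   | inj₂ h₁ | inj₂ h₂ = contra {l} {r} pm (dense d) h₁ h₂

  private
    improve* : ∀ m → b ≤ m → P b x y p → p ↭ L → ∃ λ p' → P 0 x y p' × p' ↭ L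
    improve* {b = zero}  _ _ Q pm = _ , Q , pm
    improve* {b = suc b} (suc m) (s≤s b≤m) Q pm with improve Q pm
    ... | b' , p' , le , Q' , pm' = improve* m (≤-trans le b≤m) Q' pm'

  twoOpt : P b x y p → p ↭ L → ∃ λ p' → P 0 x y p' × p' ↭ L
  twoOpt = improve* _ ≤-refl

-- Passes from one stage of a 2-opt argument to the next: steps that the new graph lacks become bad.
-- Membership in `p` is offered because the kind of a bad step may depend on its ends lying in the
-- side.
relax∈ : {E D E' D' : Rel A} → (∀ {x y} → x ∈ p → y ∈ p → E x y → E' x y ⊎ D' x y) →
  Path E D 0 x y p → ∃ λ b → Path E' D' b x y p
relax∈ h end = 0 , end
relax∈ h (good e P) with relax∈ (λ i j → h (there i) (there j)) P
... | b , P' with h (here refl) (there (first P)) e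
  where
  first : ∀ {E D : Rel A} {b x y p} → Path E D b x y p → x ∈ p
  first end        = here refl
  first (good _ _) = here refl
  first (bad _ _)  = here refl
...   | inj₁ e' = b , good e' P'
...   | inj₂ d  = suc b , bad d P'

forget : {E D D' : Rel A} → Path E D 0 x y p → Path E D' 0 x y p
forget end        = end
forget (good e P) = good e (forget P)

complete : ∀ (x : A) mid y → Path (λ _ _ → ⊤) (λ _ _ → ⊥) 0 x y (x ∷ mid ++ [ y ])
complete x []        y = good tt end
complete x (z ∷ mid) y = good tt (complete z mid y)

endpoints : {L : List A} → x ∈ L → y ∈ L → x ≢ y → ∃ λ mid → x ∷ mid ++ [ y ] ↭ L
endpoints {x = x} {y} x∈ y∈ x≢y with ∈-∃++ x∈
... | l , r , refl with ∈-∃++ (other (∈-++⁻ l y∈))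
  where
  other : y ∈ l ⊎ y ∈ x ∷ r → y ∈ l ++ r
  other (inj₁ i)           = ∈-++⁺ˡ i
  other (inj₂ (here refl)) = contradiction refl x≢y
  other (inj₂ (there i))   = ∈-++⁺ʳ l i
...   | l' , r' , eq = l' ++ r' , ↭-trans (prep x moved) (↭-sym (shift x l r))
  where
  moved : (l' ++ r') ++ [ y ] ↭ l ++ r
  moved = ↭-trans (++-comm (l' ++ r') [ y ]) (↭-trans (↭-sym (shift y l' r')) (↭-reflexive (sym eq)))

∈-filterᵇ⁻ : (s : A → Bool) {xs : List A} → x ∈ filterᵇ s xs → s x ≡ true
∈-filterᵇ⁻ s {xs} i = Equivalence.to T-≡ (proj₂ (∈-filter⁻ (T? ∘ s) {xs = xs} i))

∈-filterᵇ⁺ : (s : A → Bool) {xs : List A} → x ∈ xs → s x ≡ true → x ∈ filterᵇ s xs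
∈-filterᵇ⁺ s i sx = ∈-filter⁺ (T? ∘ s) i (Equivalence.from T-≡ sx)

-- The core is turned into a clique first; the vertices outside it are
-- settled before the missing edges of the core are avoided.
hamPath : (side core : Fin n → Bool) → (∀ v → core v ≡ true → side v ≡ true) →
  (e : Graph n) → (∀ x y → e x y ≡ true → e y x ≡ true) →
  (∀ u v → core u ≡ true → core v ≡ true →
    # side + 3 ≤ # (λ w → e u w ∧ side w) + # (λ w → e v w ∧ side w)) →
  (∀ u v → side u ≡ true → core u ≡ false → core v ≡ true →
    # side + 3 ≤ # (λ w → e u w ∧ core w) + # core) →
  # side + 3 ≤ # core + # core →
  ∀ {x y} → side x ≡ true → side y ≡ true → x ≢ y →
  ∃ λ p → Path (e ⇒ᵇ) (λ _ _ → ⊥) 0 x y p × p ↭ filterᵇ side (allFin n)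
hamPath {n} side core core⊆ e sym-e h₁ h₂ h₃ {x} {y} sx sy x≢y =
  let mid , π      = endpoints (∈-filterᵇ⁺ side (∈-allFin x) sx) (∈-filterᵇ⁺ side (∈-allFin y) sy) x≢y
      _ , P₃       = relax∈ {E' = e₂ ⇒ᵇ} {D'₃} (λ {u} {v} _ _ _ → split₃ u v) (complete x mid y)
      p₂ , Q₂ , π₂ = TwoOpt.twoOpt e₂ sym₂ D'₃ (λ (a , b) → b , a) L dense₃ P₃ π
      _ , P₂       = relax∈ {E' = e₁ ⇒ᵇ} {D'₂} (λ {u} {v} i j → split₂ u v (in-side π₂ i) (in-side π₂ j)) Q₂
      p₁ , Q₁ , π₁ = TwoOpt.twoOpt e₁ sym₁ D'₂ (λ { (inj₁ a) → inj₂ a ; (inj₂ a) → inj₁ a }) L dense₂ P₂ π₂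
      _ , P₁       = relax∈ {E' = e ⇒ᵇ} {D'₁} (λ {u} {v} _ _ → split₁ u v) Q₁
      p₀ , Q₀ , π₀ = TwoOpt.twoOpt e sym-e D'₁ (λ (a , b) → b , a) L dense₁ P₁ π₁
  in p₀ , forget Q₀ , π₀
  where
  L = filterᵇ side (allFin n)

  in-side : ∀ {p u} → p ↭ L → u ∈ p → side u ≡ true
  in-side π i = ∈-filterᵇ⁻ side {allFin n} (∈-resp-↭ π i)

  -- Two vertices outside the core may have too small a degree sum in `e`. In `e₂` a core vertex is
  -- adjacent to everything, so twice the core suffices for such a pair. In `e₁` a bad step has
  -- exactly one end in the core, and that end sees the whole core. In `e` both ends of a bad step
  -- are core vertices of large degree. Each stage thus meets one kind of bad step.
  e₂ e₁ : Graph n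
  e₂ u v = core u ∨ core v
  e₁ u v = (core u ∧ core v) ∨ e u v

  D'₃ D'₂ D'₁ Mixed : Fin n → Fin n → Set
  Mixed u v = side u ≡ true × core u ≡ false × core v ≡ true
  D'₃ u v = core u ≡ false × core v ≡ false
  D'₂ u v = Mixed u v ⊎ Mixed v u
  D'₁ u v = core u ≡ true × core v ≡ true

  sym₂ : ∀ u v → e₂ u v ≡ true → e₂ v u ≡ true
  sym₂ u v = trans (∨-comm (core v) (core u))

  sym₁ : ∀ u v → e₁ u v ≡ true → e₁ v u ≡ true
  sym₁ u v h with ∨⁻ h
  ... | inj₁ a = ∨⁺ˡ (trans (∧-comm (core v) (core u)) a)
  ... | inj₂ a = ∨⁺ʳ (sym-e u v a)

  split₃ : ∀ u v → e₂ u v ≡ true ⊎ D'₃ u v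
  split₃ u v with core u | core v
  ... | true  | _     = inj₁ refl
  ... | false | true  = inj₁ refl
  ... | false | false = inj₂ (refl , refl)

  split₂ : ∀ u v → side u ≡ true → side v ≡ true → e₂ u v ≡ true → e₁ u v ≡ true ⊎ D'₂ u v
  split₂ u v su sv h with core u | core v
  ... | true  | true  = inj₁ refl
  ... | true  | false = inj₂ (inj₂ (sv , refl , refl))
  ... | false | true  = inj₂ (inj₁ (su , refl , refl))

  split₁ : ∀ u v → e₁ u v ≡ true → e u v ≡ true ⊎ D'₁ u v
  split₁ u v h with core u | core v
  ... | true  | true  = inj₂ (refl , refl)
  ... | true  | false = inj₁ h
  ... | false | _     = inj₁ h

  length-L : length L ≡ # side
  length-L = length-filterᵇ side (allFin n)

  cnt-L : ∀ {f g : Fin n → Bool} → (∀ w → f w ≡ true → side w ≡ true → g w ≡ true) →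
    # (λ w → f w ∧ side w) ≤ cnt g L
  cnt-L {f} {g} f⊆g = ≤-trans (#-⊆ λ w h → ∧⁺ (f⊆g w (proj₁ (∧⁻ h)) (proj₂ (∧⁻ h))) (proj₂ (∧⁻ {f w} h)))
    (≤-reflexive (sym (cnt-filter g side (allFin n))))

  core-L : ∀ {g : Fin n → Bool} → (∀ w → core w ≡ true → g w ≡ true) → # core ≤ cnt g L
  core-L h = ≤-trans (#-⊆ λ w c → ∧⁺ {core w} c (core⊆ w c)) (cnt-L λ w c _ → h w c)

  dense₃ : ∀ {u v} → D'₃ u v → length L + 3 ≤ cnt (e₂ u) L + cnt (e₂ v) L
  dense₃ {u} {v} _ rewrite length-L =
    ≤-trans h₃ (+-mono-≤ (core-L λ w → ∨⁺ʳ {core u}) (core-L λ w → ∨⁺ʳ {core v}))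

  mixed : ∀ {u v} → Mixed u v → length L + 3 ≤ cnt (e₁ u) L + cnt (e₁ v) L
  mixed {u} {v} (su , cu , cv) rewrite length-L = ≤-trans (h₂ u v su cu cv) (+-mono-≤
    (≤-trans (#-⊆ λ w h → ∧⁺ (proj₁ (∧⁻ h)) (core⊆ w (proj₂ (∧⁻ {e u w} h))))
             (cnt-L λ w h _ → ∨⁺ʳ {core u ∧ core w} h))
    (core-L λ w c → ∨⁺ˡ (∧⁺ cv c)))

  dense₂ : ∀ {u v} → D'₂ u v → length L + 3 ≤ cnt (e₁ u) L + cnt (e₁ v) L
  dense₂ (inj₁ m) = mixed m
  dense₂ {u} {v} (inj₂ m) rewrite +-comm (cnt (e₁ u) L) (cnt (e₁ v) L) = mixed m

  dense₁ : ∀ {u v} → D'₁ u v → length L + 3 ≤ cnt (e u) L + cnt (e v) L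
  dense₁ {u} {v} (cu , cv) rewrite length-L =
    ≤-trans (h₁ u v cu cv) (+-mono-≤ (cnt-L λ _ h _ → h) (cnt-L λ _ h _ → h))

-- Hamiltonian cycles

Unique-↭ : {xs ys : List A} → xs ↭ ys → Unique xs → Unique ys
Unique-↭ π = SetoidPerm.Unique-resp-↭ (setoid _) (↭⇒↭ₛ π)

lookup-injective : {xs : List A} → Unique xs → ∀ i j → lookupᴸ xs i ≡ lookupᴸ xs j → i ≡ j
lookup-injective (_ ∷ _)  zero    zero    _  = refl
lookup-injective (x∉ ∷ _) zero    (suc j) eq = contradiction eq (All.lookup x∉ (∈-lookup j))
lookup-injective (x∉ ∷ _) (suc i) zero    eq = contradiction (sym eq) (All.lookup x∉ (∈-lookup i))
lookup-injective (_ ∷ u)  (suc i) (suc j) eq = cong suc (lookup-injective u i j eq)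

module _ {E : Rel A} where

  lookup-first : Path E (λ _ _ → ⊥) 0 x y p → ∀ j → toℕ j ≡ 0 → lookupᴸ p j ≡ x
  lookup-first end        zero _ = refl
  lookup-first (good _ _) zero _ = refl

  lookup-last : Path E (λ _ _ → ⊥) 0 x y p → ∀ i → suc (toℕ i) ≡ length p → lookupᴸ p i ≡ y
  lookup-last end                zero    _  = refl
  lookup-last (good _ P)         (suc i) eq = lookup-last P i (suc-injective eq)
  lookup-last (good _ end)       zero    ()
  lookup-last (good _ (good _ _)) zero   ()

  lookup-step : Path E (λ _ _ → ⊥) 0 x y p → ∀ i j → suc (toℕ i) ≡ toℕ j → E (lookupᴸ p i) (lookupᴸ p j)
  lookup-step end        zero    zero    ()
  lookup-step (good {p = p} e P) zero    (suc j) eq rewrite lookup-first P j (sym (suc-injective eq)) = e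
  lookup-step (good _ P) (suc i) (suc j) eq = lookup-step P i j (suc-injective eq)

closePath : {e : Graph n} {x y : Fin n} {p : List (Fin n)} → 3 ≤ n →
  Path (e ⇒ᵇ) (λ _ _ → ⊥) 0 x y p → e y x ≡ true → p ↭ allFin n → HamCycle e
closePath {n} {e} {x} {y} {p} 3≤n P yx π = record
  { order = 3≤n
  ; c     = λ i → lookupᴸ p (ix i)
  ; inj   = λ {i} {j} eq → ix-injective (lookup-injective (Unique-↭ (↭-sym π) (allFin⁺ n)) (ix i) (ix j) eq)
  ; adj   = adj
  }
  where
  len : n ≡ length p
  len = sym (trans (↭-length π) (length-tabulate id))

  ix : Fin n → Fin (length p)
  ix = cast len

  ix-injective : ∀ {i j} → ix i ≡ ix j → i ≡ j
  ix-injective {i} {j} eq = toℕ-injective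
    (trans (sym (toℕ-cast len i)) (trans (cong toℕ eq) (toℕ-cast len j)))

  adj : ∀ i j → Next i j → e (lookupᴸ p (ix i)) (lookupᴸ p (ix j)) ≡ true
  adj i j (inj₁ eq) = lookup-step P (ix i) (ix j)
    (trans (cong suc (toℕ-cast len i)) (trans eq (sym (toℕ-cast len j))))
  adj i j (inj₂ (eq , eq₀)) = subst₂ (λ u v → e u v ≡ true)
    (sym (lookup-last P (ix i) (trans (cong suc (toℕ-cast len i)) (trans eq len))))
    (sym (lookup-first P (ix j) (trans (toℕ-cast len j) eq₀))) yx

next? : (i j : Fin n) → Dec (Next i j)
next? {n} i j = (suc (toℕ i) ℕ.≟ toℕ j) ⊎-dec ((suc (toℕ i) ℕ.≟ n) ×-dec (toℕ j ℕ.≟ 0))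

next-functional : {i j j' : Fin n} → Next i j → Next i j' → j ≡ j'
next-functional (inj₁ a) (inj₁ b) = toℕ-injective (trans (sym a) b)
next-functional {j = j} (inj₁ a) (inj₂ (b , _)) = contradiction (trans (sym a) b) (<⇒≢ (toℕ<n j))
next-functional {j' = j} (inj₂ (b , _)) (inj₁ a) = contradiction (trans (sym a) b) (<⇒≢ (toℕ<n j))
next-functional (inj₂ (_ , a)) (inj₂ (_ , b)) = toℕ-injective (trans a (sym b))

next-injective : {i i' j : Fin n} → Next i j → Next i' j → i ≡ i'
next-injective (inj₁ a) (inj₁ b) = toℕ-injective (suc-injective (trans a (sym b)))
next-injective (inj₁ a) (inj₂ (_ , b)) = contradiction (trans a b) λ ()
next-injective (inj₂ (_ , b)) (inj₁ a) = contradiction (trans a b) λ ()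
next-injective (inj₂ (a , _)) (inj₂ (b , _)) = toℕ-injective (suc-injective (trans a (sym b)))

inCycle? : {g : Graph n} (C : HamCycle g) → ∀ x y → Dec (InCycle C x y)
inCycle? C x y = any? λ i → any? λ j → next? i j ×-dec
  (((HamCycle.c C i ≟ x) ×-dec (HamCycle.c C j ≟ y)) ⊎-dec ((HamCycle.c C i ≟ y) ×-dec (HamCycle.c C j ≟ x)))

inCycle-sym : {g : Graph n} (C : HamCycle g) → ∀ {x y} → InCycle C x y → InCycle C y x
inCycle-sym C (i , j , ij , inj₁ (a , b)) = i , j , ij , inj₂ (a , b)
inCycle-sym C (i , j , ij , inj₂ (a , b)) = i , j , ij , inj₁ (a , b)

inCycle⇒edge : {g : Graph n} (C : HamCycle g) → (∀ x y → g x y ≡ true → g y x ≡ true) →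
  ∀ {x y} → InCycle C x y → g x y ≡ true
inCycle⇒edge C sym-g (i , j , ij , inj₁ (refl , refl)) = HamCycle.adj C i j ij
inCycle⇒edge C sym-g (i , j , ij , inj₂ (refl , refl)) = sym-g _ _ (HamCycle.adj C i j ij)

mapEdges : {g h : Graph n} → (∀ x y → h x y ≡ true → g x y ≡ true) → HamCycle h → HamCycle g
mapEdges h⊆g C = record
  { order = HamCycle.order C ; c = HamCycle.c C ; inj = HamCycle.inj C
  ; adj = λ i j ij → h⊆g _ _ (HamCycle.adj C i j ij) }

-- Injectivity of `c` leaves a vertex at most one successor and one predecessor; each is found by
-- search and contributes a list of length at most one.
cycle-degree : {g : Graph n} (C : HamCycle g) → ∀ x → # (λ y → does (inCycle? C x y)) ≤ 2
cycle-degree {n} C x = ≤-trans (#-list _ (succs ++ preds) cover)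
  (≤-trans (≤-reflexive (length-++ succs)) (+-mono-≤ (short (any? succ?)) (short (any? pred?))))
  where
  open HamCycle C
  Succ Pred : Fin n → Set
  Succ y = ∃₂ λ i j → Next i j × (c i ≡ x × c j ≡ y)
  Pred y = ∃₂ λ i j → Next i j × (c i ≡ y × c j ≡ x)
  succ? : ∀ y → Dec (Succ y)
  succ? y = any? λ i → any? λ j → next? i j ×-dec ((c i ≟ x) ×-dec (c j ≟ y))
  pred? : ∀ y → Dec (Pred y)
  pred? y = any? λ i → any? λ j → next? i j ×-dec ((c i ≟ y) ×-dec (c j ≟ x))

  found : {P : Fin n → Set} → Dec (∃ P) → List (Fin n)
  found (yes (y , _)) = y ∷ []
  found (no _)        = []

  short : {P : Fin n → Set} (d : Dec (∃ P)) → length (found d) ≤ 1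
  short (yes _) = ≤-refl
  short (no _)  = z≤n

  complete-found : {P : Fin n → Set} (d : Dec (∃ P)) → (∀ {y y'} → P y → P y' → y ≡ y') → ∀ {y} → P y → y ∈ found d
  complete-found (yes (_ , q)) unique r = here (unique r q)
  complete-found (no ¬P)       unique r = contradiction (_ , r) ¬P

  succs preds : List (Fin n)
  succs = found (any? succ?)
  preds = found (any? pred?)

  succ-unique : ∀ {y y'} → Succ y → Succ y' → y ≡ y'
  succ-unique (i , j , ij , a , refl) (i' , j' , ij' , a' , refl) with inj (trans a (sym a'))
  ... | refl = cong c (next-functional ij ij')

  pred-unique : ∀ {y y'} → Pred y → Pred y' → y ≡ y'
  pred-unique (i , j , ij , refl , a) (i' , j' , ij' , refl , a') with inj (trans a (sym a'))
  ... | refl = cong c (next-injective ij ij')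

  cover : ∀ y → does (inCycle? C x y) ≡ true → y ∈ succs ++ preds
  cover y h with holds (inCycle? C x y) h
  ... | i , j , ij , inj₁ (a , b) = ∈-++⁺ˡ (complete-found (any? succ?) succ-unique (i , j , ij , a , b))
  ... | i , j , ij , inj₂ (a , b) = ∈-++⁺ʳ succs (complete-found (any? pred?) pred-unique (i , j , ij , a , b))

filterᵇ-partition : (s : A → Bool) → ∀ xs → filterᵇ s xs ++ filterᵇ (not ∘ s) xs ↭ xs
filterᵇ-partition s [] = ↭-refl
filterᵇ-partition s (x ∷ xs) with s x
... | true  = prep x (filterᵇ-partition s xs)
... | false = ↭-trans (shift x (filterᵇ s xs) _) (prep x (filterᵇ-partition s xs))

-- Kőnig's theorem

IsCover : Graph n → (Fin n → Bool) → Set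
IsCover z W = ∀ x y → z x y ≡ true → W x ≡ true ⊎ W y ≡ true

-- Its negation is the dual form of having k disjoint edges, and no list of such edges is ever
-- formed: connectivity needs only that fewer than k deleted vertices miss some edge. Covers range
-- over `Subset` to make the property decidable.
Covered : ℕ → Graph n → Set
Covered {n} k z = ∃ λ (W : Subset n) → # (lookup W) < k × IsCover z (lookup W)

covered? : ∀ k (z : Graph n) → Dec (Covered k z)
covered? k z = anySubset? λ W → (_ <? k) ×-dec
  all? λ x → all? λ y → (z x y ≟ᵇ true) →-dec ((lookup W x ≟ᵇ true) ⊎-dec (lookup W y ≟ᵇ true))

cover⇒Covered : (z : Graph n) (W : Fin n → Bool) → # W < k → IsCover z W → Covered k z
cover⇒Covered z W lt cov = vtabulate W
  , ≤-<-trans (#-⊆ (λ x → trans (sym (lookup∘tabulate W x)))) lt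
  , λ x y e → lookups (cov x y e)
  where
  lookups : ∀ {x y} → W x ≡ true ⊎ W y ≡ true → lookup (vtabulate W) x ≡ true ⊎ lookup (vtabulate W) y ≡ true
  lookups {x} {y} (inj₁ a) = inj₁ (trans (lookup∘tabulate W x) a)
  lookups {x} {y} (inj₂ a) = inj₂ (trans (lookup∘tabulate W y) a)

Missed : Graph n → (Fin n → Bool) → Set
Missed z W = ∃₂ λ x y → z x y ≡ true × W x ≡ false × W y ≡ false

¬Covered⇒Missed : (z : Graph n) → ¬ Covered k z → ∀ W → # W < k → Missed z W
¬Covered⇒Missed z ¬c W lt
  with any? (λ x → any? λ y → (z x y ≟ᵇ true) ×-dec ((W x ≟ᵇ false) ×-dec (W y ≟ᵇ false)))
... | yes m = m
... | no ¬m = contradiction (cover⇒Covered z W lt cov) ¬c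
  where
  cov : IsCover z W
  cov x y e with W x in wx | W y in wy
  ... | true  | _     = inj₁ refl
  ... | false | true  = inj₂ refl
  ... | false | false = contradiction (x , y , e , wx , wy) ¬m

delete : Graph n → Fin n → Fin n → Graph n
delete z a b x y = z x y ∧ not ((a =ᵇ x) ∧ (b =ᵇ y))

delete-⊆ : (z : Graph n) → ∀ a b x y → delete z a b x y ≡ true → z x y ≡ true
delete-⊆ z a b x y h = proj₁ (∧⁻ h)

delete-keeps : (z : Graph n) → ∀ a b {x y} → z x y ≡ true → a ≢ x ⊎ b ≢ y → delete z a b x y ≡ true
delete-keeps z a b {x} {y} e (inj₁ a≢x) rewrite dec-false (a ≟ x) a≢x | e = refl
delete-keeps z a b {x} {y} e (inj₂ b≢y) rewrite dec-false (b ≟ y) b≢y | e with a =ᵇ x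
... | true  = refl
... | false = refl

CriticalAt : ℕ → Graph n → Fin n → Fin n → Set
CriticalAt k z a b = z a b ≡ true → Covered k (delete z a b)

Covered-⊆ : {z z' : Graph n} → (∀ x y → z x y ≡ true → z' x y ≡ true) → Covered k z' → Covered k z
Covered-⊆ z⊆z' (W , lt , cov) = W , lt , λ x y e → cov x y (z⊆z' x y e)

-- One pass over all pairs suffices: a critical edge stays critical when further edges are deleted,
-- because a cover of a graph also covers its subgraphs.
critical-subgraph : (X : Graph n) → ¬ Covered k X → ∃ λ z → (∀ x y → z x y ≡ true → X x y ≡ true) ×
  ¬ Covered k z × ∀ a b → CriticalAt k z a b
critical-subgraph {n} {k} X ¬c =
  let z , z⊆X , ¬cz , crit = go (cartesianProduct (allFin n) (allFin n))
  in z , z⊆X , ¬cz , λ a b → crit (∈-cartesianProduct⁺ (∈-allFin a) (∈-allFin b))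
  where
  go : (ps : List (Fin n × Fin n)) → ∃ λ z → (∀ x y → z x y ≡ true → X x y ≡ true) ×
    ¬ Covered k z × (∀ {a b} → (a , b) ∈ ps → CriticalAt k z a b)
  go [] = X , (λ _ _ → id) , ¬c , λ ()
  go ((a , b) ∷ ps) with go ps
  ... | z , z⊆X , ¬cz , crit with covered? k (delete z a b)
  ...   | yes c = z , z⊆X , ¬cz , λ { (here refl) _ → c ; (there i) → crit i }
  ...   | no ¬c' = delete z a b , (λ x y e → z⊆X x y (delete-⊆ z a b x y e)) , ¬c' , λ
    { {_} {_} (here refl) e → contradiction refl (deleted e)
    ; {a'} {b'} (there i) e → Covered-⊆ (shrink a' b') (crit i (delete-⊆ z a b a' b' e)) }
    where
    deleted : delete z a b a b ≡ true → a ≢ a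
    deleted e with ∧⁻ {z a b} e
    ... | _ , h rewrite dec-true (a ≟ a) refl | dec-true (b ≟ b) refl = contradiction h λ ()
    shrink : ∀ a' b' x y → delete (delete z a b) a' b' x y ≡ true → delete z a' b' x y ≡ true
    shrink a' b' x y h with ∧⁻ {delete z a b x y} h
    ... | h₁ , h₂ = ∧⁺ (delete-⊆ z a b x y h₁) h₂

Bipartite : (Fin n → Bool) → Graph n → Set
Bipartite s z = ∀ x y → z x y ≡ true → s x ≡ true × s y ≡ false

-- If ab and ab' were both critical, then uncrossing covers W₁ of z - ab and
-- W₂ of z - ab' gives two covers of z (the second after adding a) that are
-- too small together.
critical⇒matching : {z : Graph n} (s : Fin n → Bool) → Bipartite s z → ¬ Covered k z →
  (∀ a b → CriticalAt k z a b) → ∀ {a b b'} → z a b ≡ true → z a b' ≡ true → b ≡ b'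
critical⇒matching {n} {k} {z} s bip ¬c crit {a} {b} {b'} e e' with b ≟ b'
... | yes b≡b' = b≡b'
... | no b≢b' with crit a b e | crit a b' e'
...   | W₁' , lt₁ , cov₁ | W₂' , lt₂ , cov₂ = contradiction too-small λ ()
  where
  W₁ W₂ M J : Fin n → Bool
  W₁ = lookup W₁'
  W₂ = lookup W₂'
  M x = if s x then W₁ x ∧ W₂ x else W₁ x ∨ W₂ x
  J x = if s x then W₁ x ∨ W₂ x else W₁ x ∧ W₂ x

  a∉ : ∀ b W → # W < k → IsCover (delete z a b) W → W a ≡ false
  a∉ b W lt cov = ¬-not λ wa → ¬c (cover⇒Covered z W lt (full wa))
    where
    full : W a ≡ true → IsCover z W
    full wa x y h with a ≟ x
    ... | yes refl = inj₁ wa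
    ... | no a≢x = cov x y (delete-keeps z a b h (inj₁ a≢x))

  M-end : ∀ {y} → s y ≡ false → W₁ y ≡ true ⊎ W₂ y ≡ true → M y ≡ true
  M-end sy (inj₁ h) rewrite sy = ∨⁺ˡ h
  M-end {y} sy (inj₂ h) rewrite sy = ∨⁺ʳ {W₁ y} h

  at-a : ∀ b {y} W → W a ≡ false → IsCover (delete z a b) W → z a y ≡ true → b ≢ y → W y ≡ true
  at-a b {y} W wa cov h b≢y with cov a y (delete-keeps z a b h (inj₂ b≢y))
  ... | inj₁ wa' = clashᵇ wa' wa
  ... | inj₂ wy = wy

  -- Both covers avoid `a`, so `W₁` contains all neighbours of `a` except possibly `b`, and `W₂` all
  -- except possibly `b'`. Since these differ, the union on the far side contains every neighbour of
  -- `a`.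
  M-cover : IsCover z M
  M-cover x y h with a ≟ x
  ... | yes refl with b ≟ y
  ...   | no b≢y  = inj₂ (M-end (proj₂ (bip x y h)) (inj₁ (at-a b W₁ (a∉ b W₁ lt₁ cov₁) cov₁ h b≢y)))
  ...   | yes refl = inj₂ (M-end (proj₂ (bip x y h)) (inj₂ (at-a b' W₂ (a∉ b' W₂ lt₂ cov₂) cov₂ h (b≢b' ∘ sym))))
  M-cover x y h | no a≢x with cov₁ x y (delete-keeps z a b h (inj₁ a≢x)) | cov₂ x y (delete-keeps z a b' h (inj₁ a≢x))
  ...   | inj₂ h₁ | _       = inj₂ (M-end (proj₂ (bip x y h)) (inj₁ h₁))
  ...   | inj₁ _  | inj₂ h₂ = inj₂ (M-end (proj₂ (bip x y h)) (inj₂ h₂))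
  ...   | inj₁ h₁ | inj₁ h₂ = inj₁ (both (proj₁ (bip x y h)))
    where
    both : s x ≡ true → M x ≡ true
    both sx rewrite sx = ∧⁺ h₁ h₂

  J-cover : IsCover z (λ x → (a =ᵇ x) ∨ J x)
  J-cover x y h with a ≟ x
  ... | yes _ = inj₁ refl
  ... | no a≢x with cov₁ x y (delete-keeps z a b h (inj₁ a≢x)) | cov₂ x y (delete-keeps z a b' h (inj₁ a≢x))
  ...   | inj₁ h₁ | _       = inj₁ (either (proj₁ (bip x y h)))
    where
    either : s x ≡ true → J x ≡ true
    either sx rewrite sx = ∨⁺ˡ h₁
  ...   | inj₂ _  | inj₁ h₂ = inj₁ (either (proj₁ (bip x y h)))
    where
    either : s x ≡ true → J x ≡ true
    either sx rewrite sx = ∨⁺ʳ {W₁ x} h₂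
  ...   | inj₂ h₁ | inj₂ h₂ = inj₂ (∨⁺ʳ {a =ᵇ y} (both (proj₂ (bip x y h))))
    where
    both : s y ≡ false → J y ≡ true
    both sy rewrite sy = ∧⁺ h₁ h₂

  k≤M : k ≤ # M
  k≤M = ≮⇒≥ λ lt → ¬c (cover⇒Covered z M lt M-cover)

  k≤J : k ≤ 1 + # J
  k≤J = ≤-trans (≮⇒≥ λ lt → ¬c (cover⇒Covered z _ lt J-cover)) (≤-trans (#-∨ (a =ᵇ_) J) (+-monoˡ-≤ (# J) (#-single a)))

  uncross : # M + # J ≤ # W₁ + # W₂
  uncross = #-mono₂ λ x → eq (s x) (W₁ x) (W₂ x)
    where
    eq : ∀ t u v → ι (if t then u ∧ v else u ∨ v) + ι (if t then u ∨ v else u ∧ v) ≤ ι u + ι v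
    eq true  true  true  = ≤-refl
    eq true  true  false = ≤-refl
    eq true  false v     = ≤-refl
    eq false true  true  = ≤-refl
    eq false true  false = ≤-refl
    eq false false true  = ≤-refl
    eq false false false = ≤-refl

  too-small : 1 ≤ 0
  too-small = lin 0 (+-mono-≤ k≤M (+-mono-≤ k≤J (+-mono-≤ uncross (+-mono-≤ lt₁ lt₂)))) (arith k (# M) (# J) (# W₁) (# W₂))
    where
    arith : ∀ k m j w v → 1 + (m + (1 + j + (w + v + (k + k)))) + 0 ≡ 0 + (k + (k + (m + j + (1 + w + (1 + v)))))
    arith = solve-∀

Covered-flip : {z : Graph n} → Covered k z → Covered k (flip z)
Covered-flip (W , lt , cov) = W , lt , λ x y e → ⊎-swap (cov y x e)

-- An edge-critical z is a matching, and a cover of z minus one edge ab has at most k - 1 vertices, so z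
-- touches only these, their partners, a and b.
kernel : (s : Fin n → Bool) (X : Graph n) → Bipartite s X → ¬ Covered k X →
  ∃ λ z → (∀ x y → z x y ≡ true → X x y ≡ true) × ¬ Covered k z ×
  ∃ λ T → length T ≤ 2 * k × (∀ x y → z x y ≡ true → x ∈ T × y ∈ T)
kernel {n} {k} s X bip ¬c with critical-subgraph X ¬c
... | z , z⊆X , ¬cz , crit with any? (λ a → any? λ b → z a b ≟ᵇ true)
...   | no none = z , z⊆X , ¬cz , [] , z≤n , λ x y e → contradiction (x , y , e) none
...   | yes (a , b , e) with crit a b e
...     | W , lt , cov = z , z⊆X , ¬cz , T , size , touched
  where
  bip-z : Bipartite s z
  bip-z x y h = bip x y (z⊆X x y h)

  unique-right : ∀ {a b b'} → z a b ≡ true → z a b' ≡ true → b ≡ b'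
  unique-right = critical⇒matching s bip-z ¬cz crit

  unique-left : ∀ {a a' b} → z a b ≡ true → z a' b ≡ true → a ≡ a'
  unique-left = critical⇒matching {k = k} {z = flip z} (not ∘ s)
    (λ x y h → not⁺ (proj₂ (bip-z y x h)) , cong not (proj₁ (bip-z y x h)))
    (¬cz ∘ Covered-flip) (λ b a h → Covered-⊆ (shrink a b) (Covered-flip (crit a b h)))
    where
    shrink : ∀ a b x y → delete (flip z) b a x y ≡ true → delete z a b y x ≡ true
    shrink a b x y h with z y x | a =ᵇ y | b =ᵇ x
    ... | true | false | false = refl
    ... | true | false | true  = refl
    ... | true | true  | false = refl

  Partner : Fin n → Fin n → Set
  Partner w y = z w y ≡ true ⊎ z y w ≡ true

  choose : ∀ w → Dec (∃ (Partner w)) → Fin n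
  choose w (yes (y , _)) = y
  -- A default for vertices without a partner; it only pads the list `T`.
  choose w (no _)        = w

  partner? : ∀ w → Dec (∃ (Partner w))
  partner? w = any? λ y → (z w y ≟ᵇ true) ⊎-dec (z y w ≟ᵇ true)

  partner : Fin n → Fin n
  partner w = choose w (partner? w)

  clash : ∀ {w y y'} {P : Set} → z w y ≡ true → z y' w ≡ true → P
  clash h h' = clashᵇ (proj₁ (bip-z _ _ h)) (proj₂ (bip-z _ _ h'))

  choose-unique : ∀ {w y} d → Partner w y → y ≡ choose w d
  choose-unique (no ¬p) q = contradiction (_ , q) ¬p
  choose-unique (yes (_ , inj₁ h)) (inj₁ h') = unique-right h' h
  choose-unique (yes (_ , inj₁ h)) (inj₂ h') = clash h h'
  choose-unique (yes (_ , inj₂ h)) (inj₁ h') = clash h' h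
  choose-unique (yes (_ , inj₂ h)) (inj₂ h') = unique-left h' h

  Ws T : List (Fin n)
  Ws = filterᵇ (lookup W) (allFin n)
  T = a ∷ b ∷ Ws ++ map partner Ws

  size : length T ≤ 2 * k
  size rewrite length-++ Ws {map partner Ws} | length-map partner Ws | length-filterᵇ (lookup W) (allFin n) =
    lin 0 (+-mono-≤ lt lt) (arith k (# (lookup W)))
    where
    arith : ∀ k w → 2 + (w + w) + (k + k) + 0 ≡ 2 * k + (1 + w + (1 + w))
    arith = solve-∀

  inWs : ∀ {x} → lookup W x ≡ true → x ∈ Ws
  inWs h = ∈-filterᵇ⁺ (lookup W) (∈-allFin _) h

  near : ∀ {w y} → lookup W w ≡ true → Partner w y → w ∈ T × y ∈ T
  near {w} {y} h q = there (there (∈-++⁺ˡ (inWs h))) ,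
    there (there (∈-++⁺ʳ Ws (subst (_∈ map partner Ws) (sym (choose-unique (partner? w) q)) (∈-map⁺ partner (inWs h)))))

  by-cover : ∀ {x y} → z x y ≡ true → lookup W x ≡ true ⊎ lookup W y ≡ true → x ∈ T × y ∈ T
  by-cover h (inj₁ wx) = near wx (inj₁ h)
  by-cover h (inj₂ wy) = ×-swap (near wy (inj₂ h))

  touched : ∀ x y → z x y ≡ true → x ∈ T × y ∈ T
  touched x y h with a ≟ x | b ≟ y
  ... | yes refl | yes refl = here refl , there (here refl)
  ... | yes _    | no b≢y   = by-cover h (cov x y (delete-keeps z a b h (inj₂ b≢y)))
  ... | no a≢x   | _        = by-cover h (cov x y (delete-keeps z a b h (inj₁ a≢x)))

-- Degrees at a sparse cut

#-member : {f : Fin n → Bool} {v : Fin n} → f v ≡ true → 1 ≤ # f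
#-member {n} {f} {v} fv = go (∈-allFin v)
  where
  go : ∀ {xs} → v ∈ xs → 1 ≤ cnt f xs
  go (here refl) rewrite fv = s≤s z≤n
  go {x ∷ xs} (there i) = ≤-trans (go i) (m≤n+m _ (ι (f x)))

#-⊂ : {f g : Fin n → Bool} {v : Fin n} → (∀ x → g x ≡ true → f x ≡ true) →
  f v ≡ true → g v ≡ false → # g + 1 ≤ # f
#-⊂ {f = f} {g} {v} g⊆f fv gv = ≤-trans
  (+-mono-≤ (#-⊆ {f = g} λ x h → ∧⁺ (g⊆f x h) h) (#-member {f = λ x → f x ∧ not (g x)} {v} (∧⁺ fv (not⁺ gv))))
  (≤-reflexive (sym (#-split f g)))

#-⊂₂ : {f g : Fin n → Bool} {u v : Fin n} → (∀ x → g x ≡ true → f x ≡ true) → u ≢ v →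
  f u ≡ true → g u ≡ false → f v ≡ true → g v ≡ false → # g + 2 ≤ # f
#-⊂₂ {f = f} {g} {u} {v} g⊆f u≢v fu gu fv gv = ≤-trans (≤-reflexive (sym (+-assoc (# g) 1 1)))
  (≤-trans (+-monoˡ-≤ 1 (#-⊂ {f = h} {v = u} sub hu gu)) (#-⊂ {f = f} {h} {v} (λ x → proj₁ ∘ ∧⁻) fv hv))
  where
  h : Fin _ → Bool
  h x = f x ∧ not (v =ᵇ x)
  sub : ∀ x → g x ≡ true → h x ≡ true
  sub x gx = ∧⁺ (g⊆f x gx) (not⁺ (dec-false (v ≟ x) λ { refl → clashᵇ gx gv }))
  hu : h u ≡ true
  hu = ∧⁺ fu (not⁺ (dec-false (v ≟ u) (u≢v ∘ sym)))
  hv : h v ≡ false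
  hv rewrite dec-true (v ≟ v) refl | fv = refl

#-mono₃ : {f a b c : Fin n → Bool} → (∀ x → ι (f x) ≤ ι (a x) + ι (b x) + ι (c x)) → # f ≤ # a + # b + # c
#-mono₃ {n} {f} {a} {b} {c} le = ≤-trans (sumOn-mono le (allFin n)) (≤-reflexive (trans
  (sumOn-+ (λ x → ι (a x) + ι (b x)) (ι ∘ c) (allFin n)) (cong (_+ # c) (sumOn-+ (ι ∘ a) (ι ∘ b) (allFin n)))))

deg≡# : (g : Graph n) (v : Fin n) → deg g v ≡ # (g v)
deg≡# {n} g v = length-filterᵇ (g v) (allFin n)

outside : (A B : Fin n → Bool) → Fin n → Bool
outside A B x = not (A x ∨ B x)

-- s is the number of vertices outside the cores of both sides.
record Half (p s : ℕ) (g : Graph n) (side core : Fin n → Bool) : Set where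
  field
    core⊆side    : ∀ v → core v ≡ true → side v ≡ true
    core-degree  : ∀ v → core v ≡ true → n ≤ 2 * # (λ w → g v w ∧ core w) + 2 * s + 2 * p
    extra-degree : ∀ v → side v ≡ true → core v ≡ false → n + 2 ≤ 4 * # (λ w → g v w ∧ core w) + 2 * s
    core-upper   : 2 * # core + 2 ≤ n + 2 * p
    core-lower   : n + 2 ≤ 2 * # core + 2 * s + 2 * p
    side-upper   : # side ≤ # core + s

module _ (g : Graph n) (irr : ∀ i → g i i ≡ false) (half-degree : MinDegHalf g) (p : ℕ) where

  degree-split : (A B : Fin n → Bool) → ∀ v →
    n ≤ 2 * (# (λ w → g v w ∧ A w) + # (λ w → g v w ∧ B w) + # (λ w → g v w ∧ outside A B w))
  degree-split A B v = ≤-trans (half-degree v) (*-monoʳ-≤ 2 (≤-trans (≤-reflexive (deg≡# g v))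
    (#-mono₃ λ w → le (g v w) (A w) (B w))))
    where
    le : ∀ e a b → ι e ≤ ι (e ∧ a) + ι (e ∧ b) + ι (e ∧ not (a ∨ b))
    le false _ _ = z≤n
    le true false false = ≤-refl
    le true false true  = ≤-refl
    le true true  _     = s≤s z≤n

  core-degree′ : (A B : Fin n → Bool) → ∀ v → # (λ w → g v w ∧ B w) ≤ p →
    n ≤ 2 * # (λ w → g v w ∧ A w) + 2 * # (outside A B) + 2 * p
  core-degree′ A B v le = ≤-trans (degree-split A B v) (lin 0
    (*-monoʳ-≤ 2 (+-mono-≤ le (#-⊆ {f = λ w → g v w ∧ outside A B w} {outside A B} λ w → proj₂ ∘ ∧⁻)))
    (arith (# (λ w → g v w ∧ A w)) (# (λ w → g v w ∧ B w)) (# (λ w → g v w ∧ outside A B w)) (# (outside A B)) p))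
    where
    arith : ∀ a b c s p → 2 * (a + b + c) + 2 * (p + s) + 0 ≡ 2 * a + 2 * s + 2 * p + 2 * (b + c)
    arith = solve-∀

  -- A vertex is not its own neighbour, so the core exceeds its inner degree by at least one;
  -- doubled, this is the 2 on the left.
  core-size : (A B : Fin n → Bool) → ∀ v → A v ≡ true → # (λ w → g v w ∧ B w) ≤ p →
    n + 2 ≤ 2 * # A + 2 * # (outside A B) + 2 * p
  core-size A B v av le = lin 0
    (+-mono-≤ (core-degree′ A B v le) (*-monoʳ-≤ 2 (#-⊂ {f = A} {λ w → g v w ∧ A w} {v} (λ w → proj₂ ∘ ∧⁻) av no-loop)))
    (arith n (# (λ w → g v w ∧ A w)) (# A) (# (outside A B)) p)
    where
    no-loop : g v v ∧ A v ≡ false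
    no-loop rewrite irr v = refl
    arith : ∀ n d a s p → n + 2 + (2 * d + 2 * s + 2 * p + 2 * a) + 0 ≡ 2 * a + 2 * s + 2 * p + (n + 2 * (d + 1))
    arith = solve-∀

  half : (side A B : Fin n → Bool) → ∀ {s} → # (outside A B) ≡ s →
    (∀ v → A v ≡ true → side v ≡ true) →
    (∀ v → side v ≡ true → A v ≡ false → B v ≡ false × # (λ w → g v w ∧ B w) ≤ # (λ w → g v w ∧ A w)) →
    (∀ v → A v ≡ true → B v ≡ false) →
    (∀ v → A v ≡ true → # (λ w → g v w ∧ B w) ≤ p) → ∃ (λ v → A v ≡ true) →
    n + 2 ≤ 2 * # B + 2 * s + 2 * p →
    Half p s g side A
  half side A B {s} refl A⊆ extra disj sparse (a , Aa) size-B = record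
    { core⊆side    = A⊆
    ; core-degree  = λ v av → core-degree′ A B v (sparse v av)
    ; extra-degree = extra-degree
    -- The opposite core is large and disjoint from this one. Its lower bound is weakened by `s`,
    -- but `s` vertices also lie outside both cores, so `s` cancels.
    ; core-upper   = lin 0 (+-mono-≤ size-B (*-monoʳ-≤ 2 total)) (arith₁ n (# A) (# B) s p)
    ; core-lower   = core-size A B a Aa (sparse a Aa)
    ; side-upper   = ≤-trans (#-⊆ covers) (#-∨ A (outside A B))
    }
    where
    -- Of the at least n/2 neighbours of `v`, at most `s` - 1 lie outside both cores, as `v` itself
    -- is one of those `s` vertices. At least half of the others lie in the core of its own side,
    -- which turns the factor 2 into 4.
    extra-degree : ∀ v → side v ≡ true → A v ≡ false → n + 2 ≤ 4 * # (λ w → g v w ∧ A w) + 2 * s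
    extra-degree v sv av with extra v sv av
    ... | bv , le = lin 0
      (+-mono-≤ (degree-split A B v) (+-mono-≤ (*-monoʳ-≤ 2 le)
        (*-monoʳ-≤ 2 (#-⊂ {f = outside A B} {λ w → g v w ∧ outside A B w} {v} (λ w → proj₂ ∘ ∧⁻) out no-loop))))
      (arith₂ n (# (λ w → g v w ∧ A w)) (# (λ w → g v w ∧ B w)) (# (λ w → g v w ∧ outside A B w)) s)
      where
      out : outside A B v ≡ true
      out rewrite av | bv = refl
      no-loop : g v v ∧ outside A B v ≡ false
      no-loop rewrite irr v = refl
      arith₂ : ∀ n a b c s → n + 2 + (2 * (a + b + c) + (2 * a + 2 * s)) + 0 ≡
        4 * a + 2 * s + (n + (2 * b + 2 * (c + 1)))
      arith₂ = solve-∀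

    total : # A + # B + s ≤ n
    total = subst (# A + # B + # (outside A B) ≤_) (#-true n) (≤-trans (≤-reflexive (sym (trans
      (sumOn-+ (λ x → ι (A x) + ι (B x)) (ι ∘ outside A B) (allFin n)) (cong (_+ s) (sumOn-+ (ι ∘ A) (ι ∘ B) (allFin n))))))
      (sumOn-mono {h = λ x → ι (A x) + ι (B x) + ι (outside A B x)} {k = λ _ → 1} (λ x → le (A x) (B x) (disj x)) (allFin n)))
      where
      le : ∀ a b → (a ≡ true → b ≡ false) → ι a + ι b + ι (not (a ∨ b)) ≤ 1
      le false false _ = ≤-refl
      le false true _  = ≤-refl
      le true false _  = ≤-refl
      le true true h   = contradiction (h refl) λ ()

    covers : ∀ v → side v ≡ true → A v ∨ outside A B v ≡ true
    covers v sv with A v in av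
    ... | true  = refl
    ... | false rewrite proj₁ (extra v sv av) = refl

    arith₁ : ∀ n a b s p → 2 * a + 2 + (2 * b + 2 * s + 2 * p + 2 * n) + 0 ≡ n + 2 * p + (n + 2 + 2 * (a + b + s))
    arith₁ = solve-∀

record Large (n k p q s : ℕ) : Set where
  field
    large : 6 * k + 6 * p + 8 * q ≤ n + 10
    s<k   : s < k
    1≤p   : 1 ≤ p

module HalfBounds {p s : ℕ} {g : Graph n} {side core : Fin n → Bool} (H : Half p s g side core)
  {k q : ℕ} (N : Large n k p q s) where
  open Half H
  open Large N

  -- Serves twice: with `i` below `q` it gives the density for the next cycle, and with `i` equal to
  -- `q` the connectivity of a side after all cycles. Reserved edges run between the sides, so
  -- excluding them costs no degree here.
  module Remaining (e r : Graph n) (i : ℕ) (r-degree : ∀ v → # (r v) ≤ 2 * i)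
    (remains : ∀ v w → side v ≡ true → side w ≡ true → g v w ≡ true → e v w ≡ true ⊎ r v w ≡ true) where

    lose : ∀ v → side v ≡ true → # (λ w → g v w ∧ core w) ≤ # (λ w → e v w ∧ core w) + 2 * i
    lose v sv = ≤-trans (≤-trans (#-⊆ sub) (#-∨ (λ w → e v w ∧ core w) (r v))) (+-monoʳ-≤ _ (r-degree v))
      where
      sub : ∀ w → g v w ∧ core w ≡ true → (e v w ∧ core w) ∨ r v w ≡ true
      sub w h with ∧⁻ h
      ... | gvw , cw with remains v w sv (core⊆side w cw) gvw
      ...   | inj₁ evw = ∨⁺ˡ (∧⁺ evw cw)
      ...   | inj₂ rvw = ∨⁺ʳ {e v w ∧ core w} rvw

    -- Each core vertex keeps n/2 - s - p - 2i neighbours in the core, while the side has at most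
    -- n/2 + p + s - 1 vertices. The inequality thus needs n ≥ 6s + 6p + 8i + 4, and s ≤ k - 1, i ≤
    -- q - 1 make this exactly n ≥ 6k + 6p + 8q - 10, the estimate `large`.
    core-pair : i < q → ∀ u v → core u ≡ true → core v ≡ true →
      # side + 3 ≤ # (λ w → e u w ∧ side w) + # (λ w → e v w ∧ side w)
    core-pair i<q u v cu cv = ≤-trans (*-cancelˡ-≤ 2 (lin 0
      (+-mono-≤ (core-degree u cu) (+-mono-≤ (core-degree v cv) (+-mono-≤ (*-monoʳ-≤ 2 (lose u (core⊆side u cu)))
        (+-mono-≤ (*-monoʳ-≤ 2 (lose v (core⊆side v cv))) (+-mono-≤ (*-monoʳ-≤ 8 i<q) (+-mono-≤ (*-monoʳ-≤ 2 side-upper)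
          (+-mono-≤ core-upper (+-mono-≤ large (*-monoʳ-≤ 6 s<k)))))))))
      (arith n k p q s i (# core) (# side) (# (λ w → g u w ∧ core w)) (# (λ w → g v w ∧ core w))
        (# (λ w → e u w ∧ core w)) (# (λ w → e v w ∧ core w)))))
      (+-mono-≤ (widen u) (widen v))
      where
      widen : ∀ u → # (λ w → e u w ∧ core w) ≤ # (λ w → e u w ∧ side w)
      widen u = #-⊆ λ w h → ∧⁺ (proj₁ (∧⁻ h)) (core⊆side w (proj₂ (∧⁻ {e u w} h)))
      arith : ∀ n k p q s i c t d d' x x' →
        2 * (t + 3) + (2 * d + 2 * s + 2 * p + (2 * d' + 2 * s + 2 * p + (2 * (x + 2 * i) + (2 * (x' + 2 * i) +
          (8 * q + (2 * (c + s) + (n + 2 * p + (n + 10 + 6 * k)))))))) + 0 ≡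
        2 * (x + x') + (n + (n + (2 * d + (2 * d' + (8 * (1 + i) + (2 * t + (2 * c + 2 + (6 * k + 6 * p + 8 * q + 6 * (1 + s)))))))))
      arith = solve-∀

    -- The side exceeds the core by at most s, so s + 3 remaining neighbours in the core are enough,
    -- and about n/4 - s/2 - 2i of them are guaranteed.
    extra-pair : i < q → ∀ v → side v ≡ true → core v ≡ false → # side + 3 ≤ # (λ w → e v w ∧ core w) + # core
    extra-pair i<q v sv cv = *-cancelˡ-≤ 4 (lin 0
      (+-mono-≤ (extra-degree v sv cv) (+-mono-≤ (*-monoʳ-≤ 4 (lose v sv)) (+-mono-≤ (*-monoʳ-≤ 8 i<q)
        (+-mono-≤ (*-monoʳ-≤ 4 side-upper) (+-mono-≤ large (+-mono-≤ (*-monoʳ-≤ 6 s<k) (*-monoʳ-≤ 6 1≤p)))))))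
      (arith n k p q s i (# core) (# side) (# (λ w → g v w ∧ core w)) (# (λ w → e v w ∧ core w))))
      where
      arith : ∀ n k p q s i c t d x →
        4 * (t + 3) + (4 * d + 2 * s + (4 * (x + 2 * i) + (8 * q + (4 * (c + s) + (n + 10 + (6 * k + 6 * p)))))) + 0 ≡
        4 * (x + c) + (n + 2 + (4 * d + (8 * (1 + i) + (4 * t + (6 * k + 6 * p + 8 * q + (6 * (1 + s) + 6 * 1))))))
      arith = solve-∀

    -- Inclusion-exclusion inside the core. For nonadjacent `u` and `v` the union of the
    -- neighbourhoods misses both, which gains 2; with this gain the count needs exactly `large`
    -- once more.
    common : q ≡ i → ∀ u v → u ≢ v → core u ≡ true → core v ≡ true → (∀ w → e w w ≡ false) →
      e u v ≡ false → e v u ≡ false → k ≤ # (λ w → (e u w ∧ core w) ∧ (e v w ∧ core w))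
    common refl u v u≢v cu cv irr uv vu = *-cancelˡ-≤ 2 (lin 0
      (+-mono-≤ (core-degree u cu) (+-mono-≤ (core-degree v cv) (+-mono-≤ (*-monoʳ-≤ 2 (lose u (core⊆side u cu)))
        (+-mono-≤ (*-monoʳ-≤ 2 (lose v (core⊆side v cv))) (+-mono-≤ core-upper (+-mono-≤ large (+-mono-≤ (*-monoʳ-≤ 4 s<k)
          (+-mono-≤ (*-monoʳ-≤ 2 (#-incl-excl (λ w → e u w ∧ core w) (λ w → e v w ∧ core w)))
            (*-monoʳ-≤ 2 union)))))))))
      (arith n k p q s (# core) (# (λ w → g u w ∧ core w)) (# (λ w → g v w ∧ core w))
        (# (λ w → e u w ∧ core w)) (# (λ w → e v w ∧ core w)) (# (λ w → (e u w ∧ core w) ∨ (e v w ∧ core w)))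
        (# (λ w → (e u w ∧ core w) ∧ (e v w ∧ core w)))))
      where
      off : ∀ {a b c d} → a ≡ false → c ≡ false → (a ∧ b) ∨ (c ∧ d) ≡ false
      off refl refl = refl
      inside : ∀ w → (e u w ∧ core w) ∨ (e v w ∧ core w) ≡ true → core w ≡ true
      inside w h with ∨⁻ h
      ... | inj₁ a = proj₂ (∧⁻ {e u w} a)
      ... | inj₂ a = proj₂ (∧⁻ {e v w} a)
      union : # (λ w → (e u w ∧ core w) ∨ (e v w ∧ core w)) + 2 ≤ # core
      union = #-⊂₂ {f = core} {u = u} {v} inside u≢v cu (off (irr u) vu) cv (off uv (irr v))
      arith : ∀ n k p q s c d d' x x' y m →
        2 * k + (2 * d + 2 * s + 2 * p + (2 * d' + 2 * s + 2 * p + (2 * (x + 2 * q) + (2 * (x' + 2 * q) +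
          (n + 2 * p + (n + 10 + (4 * k + (2 * (y + m) + 2 * c)))))))) + 0 ≡
        2 * m + (n + (n + (2 * d + (2 * d' + (2 * c + 2 + (6 * k + 6 * p + 8 * q + (4 * (1 + s) + (2 * (x + x') + 2 * (y + 2)))))))))
      arith = solve-∀

    extra-hub : q ≡ i → ∀ v → side v ≡ true → core v ≡ false → k ≤ # (λ w → e v w ∧ core w)
    extra-hub refl v sv cv = *-cancelˡ-≤ 4 (lin 0
      (+-mono-≤ (extra-degree v sv cv) (+-mono-≤ (*-monoʳ-≤ 4 (lose v sv)) (+-mono-≤ large
        (+-mono-≤ (*-monoʳ-≤ 2 s<k) (*-monoʳ-≤ 6 1≤p)))))
      (arith n k p q s (# (λ w → g v w ∧ core w)) (# (λ w → e v w ∧ core w))))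
      where
      arith : ∀ n k p q s d x →
        4 * k + (4 * d + 2 * s + (4 * (x + 2 * q) + (n + 10 + (2 * k + 6 * p)))) + 0 ≡
        4 * x + (n + 2 + (4 * d + (6 * k + 6 * p + 8 * q + (2 * (1 + s) + 6 * 1))))
      arith = solve-∀

  -- Lets a core vertex avoid the at most `2 * k + 4 * i` listed vertices and one further prescribed
  -- vertex.
  room : ∀ {i} → i < q → 2 * k + 4 * i + 1 < # core
  room {i} i<q = *-cancelˡ-≤ 2 (lin 2
    (+-mono-≤ core-lower (+-mono-≤ large (+-mono-≤ (*-monoʳ-≤ 2 s<k) (+-mono-≤ (*-monoʳ-≤ 4 1≤p) (*-monoʳ-≤ 8 i<q)))))
    (arith n k p q s i (# core)))
    where
    arith : ∀ n k p q s i c → 2 * (1 + (2 * k + 4 * i + 1)) + (2 * c + 2 * s + 2 * p + (n + 10 + (2 * k + (4 * p + 8 * q)))) + 2 ≡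
      2 * c + (n + 2 + (6 * k + 6 * p + 8 * q + (2 * (1 + s) + (4 * 1 + 8 * (1 + i)))))
    arith = solve-∀

  core-double : 1 ≤ q → # side + 3 ≤ # core + # core
  core-double 1≤q = *-cancelˡ-≤ 2 (lin (2 * s + 4)
    (+-mono-≤ core-lower (+-mono-≤ large (+-mono-≤ (*-monoʳ-≤ 6 s<k) (+-mono-≤ (*-monoʳ-≤ 4 1≤p) (+-mono-≤ (*-monoʳ-≤ 8 1≤q)
      (*-monoʳ-≤ 2 side-upper))))))
    (arith n k p q s (# core) (# side)))
    where
    arith : ∀ n k p q s c t → 2 * (t + 3) + (2 * c + 2 * s + 2 * p + (n + 10 + (6 * k + (4 * p + (8 * q + 2 * (c + s)))))) + (2 * s + 4) ≡
      2 * (c + c) + (n + 2 + (6 * k + 6 * p + 8 * q + (6 * (1 + s) + (4 * 1 + (8 * 1 + 2 * t)))))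
    arith = solve-∀

-- Building the cycles

lookup⇒∉ : {S : Subset n} {x : Fin n} → lookup S x ≡ false → x Subset.∉ S
lookup⇒∉ h i = clashᵇ ([]=⇒lookup i) h

∉⇒lookup : {S : Subset n} {x : Fin n} → x Subset.∉ S → lookup S x ≡ false
∉⇒lookup {S = S} {x} x∉ = ¬-not (x∉ ∘ lookup⇒[]= x S)

crossing : {R : Fin n → Fin n → Set} {S : Subset n} (side : Fin n → Bool) → ∀ {u v} → Walk R S u v →
  u Subset.∉ S → side u ≡ true → side v ≡ false →
  ∃₂ λ x y → R x y × x Subset.∉ S × y Subset.∉ S × side x ≡ true × side y ≡ false
crossing side here u∉ su sv = clashᵇ su sv
crossing side (step {u = u} {w} e w∉ P) u∉ su sv with side w in sw
... | true  = crossing side P w∉ sw sv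
... | false = u , w , e , u∉ , w∉ , su , sw

Across : (side : Fin n → Bool) → Graph n
Across side x y = side x ∧ not (side y)

cross-graph : Graph n → (Fin n → Bool) → Graph n
cross-graph g side x y = g x y ∧ Across side x y

cross-bipartite : (g : Graph n) (side : Fin n → Bool) → Bipartite side (cross-graph g side)
cross-bipartite g side x y h with ∧⁻ {g x y} h
... | _ , h' with ∧⁻ {side x} h'
...   | sx , sy = sx , not⁻ sy

-- A cover of fewer than k vertices would be a separator: each side has a vertex outside it, and a
-- walk between the two that avoids it has to use an uncovered crossing edge.
cross-uncovered : {g : Graph n} {side : Fin n → Bool} → KConnected k (Edge g) →
  k ≤ # side → k ≤ # (not ∘ side) → ¬ Covered k (cross-graph g side)
cross-uncovered {g = g} {side} (_ , conn) k≤ k≤' (W , lt , cov)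
  with #-witness {P = side} (<-≤-trans lt k≤) | #-witness {P = not ∘ side} (<-≤-trans lt k≤')
... | u , su , wu | v , sv , wv
  with crossing side (conn W (subst (_< _) (sym (∣∣≡# W)) lt) u v (lookup⇒∉ wu) (lookup⇒∉ wv)) (lookup⇒∉ wu) su (not⁻ sv)
... | x , y , e , x∉ , y∉ , sx , sy with cov x y (∧⁺ e (∧⁺ sx (not⁺ sy)))
...   | inj₁ wx = clashᵇ wx (∉⇒lookup x∉)
...   | inj₂ wy = clashᵇ wy (∉⇒lookup y∉)

-- Kőnig's theorem for two edges. An edge that avoids `a` is disjoint from `ab` unless it ends in
-- `b`; in that case an edge that avoids `b` is disjoint from one of these two.
two-disjoint : (s : Fin n → Bool) (F : Fin n → Fin n → Set) → (∀ {x y} → F x y → s x ≡ true × s y ≡ false) →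
  (∀ v → ∃₂ λ x y → F x y × x ≢ v × y ≢ v) → Fin n →
  ∃₂ λ a b → ∃₂ λ a' b' → F a b × F a' b' × a ≢ a' × b ≢ b'
two-disjoint s F bip avoid v₀ with avoid v₀
... | a , b , f , _ with avoid a
...   | a₁ , b₁ , f₁ , a₁≢a , _ with b ≟ b₁
...     | no b≢b₁ = a , b , a₁ , b₁ , f , f₁ , a₁≢a ∘ sym , b≢b₁
...     | yes refl with avoid b
...       | a₂ , b₂ , f₂ , _ , b₂≢b with a ≟ a₂
...         | no a≢a₂ = a , b , a₂ , b₂ , f , f₂ , a≢a₂ , b₂≢b ∘ sym
...         | yes refl = a₁ , b , a , b₂ , f₁ , f₂ , a₁≢a , b₂≢b ∘ sym

module _ {g : Graph n} (irr : ∀ i → g i i ≡ false) (half-degree : MinDegHalf g) where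

  cross-degree : (side : Fin n → Bool) → ∀ v → side v ≡ true →
    n + 2 ≤ 2 * # side + 2 * # (λ w → g v w ∧ not (side w))
  cross-degree side v sv = lin 0
    (+-mono-≤ (≤-trans (half-degree v) (*-monoʳ-≤ 2 (≤-reflexive (trans (deg≡# g v) (#-split (g v) side)))))
      (*-monoʳ-≤ 2 (#-⊂ {f = side} {λ w → g v w ∧ side w} {v} (λ w → proj₂ ∘ ∧⁻) sv no-loop)))
    (arith n (# side) (# (λ w → g v w ∧ side w)) (# (λ w → g v w ∧ not (side w))))
    where
    no-loop : g v v ∧ side v ≡ false
    no-loop rewrite irr v = refl
    arith : ∀ n t a b → n + 2 + (2 * (a + b) + 2 * t) + 0 ≡ 2 * t + 2 * b + (n + 2 * (a + 1))
    arith = solve-∀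

  Fresh : (Fin n → Bool) → List (Fin n) → Fin n → Set
  Fresh side T v = ∃₂ λ x y → side x ≡ true × side y ≡ false × g x y ≡ true × x ∉ T × x ≢ v × y ≢ v

  -- In a side below n/2 every vertex has at least two neighbours across, so one of them is not `v`.
  -- In a side of at most n/2 one neighbour across is certain, and it differs from `v` when `v` lies
  -- in the side.
  fresh : (side : Fin n → Bool) (T : List (Fin n)) → length T + 1 < # side → ∀ v →
    2 * # side < n ⊎ (2 * # side ≤ n × side v ≡ true) → Fresh side T v
  fresh side T room v size with #-avoid (v ∷ T) (subst (_< # side) (+-comm (length T) 1) room)
  ... | x , sx , x∉ with size
  ...   | inj₁ lt = let y , h , y∉ = #-avoid (v ∷ []) (*-cancelˡ-< 2 1 _ two)
                    in x , y , sx , not⁻ (proj₂ (∧⁻ {g x y} h)) , proj₁ (∧⁻ h) , x∉ ∘ there , (λ e → x∉ (here e)) , (λ e → y∉ (here e))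
    where
    two : 2 < 2 * # (λ w → g x w ∧ not (side w))
    two = lin 0 (+-mono-≤ (cross-degree side x sx) lt) (arith n (# side) (# (λ w → g x w ∧ not (side w))))
      where
      arith : ∀ n t c → 3 + (2 * t + 2 * c + n) + 0 ≡ 2 * c + (n + 2 + (1 + 2 * t))
      arith = solve-∀
  ...   | inj₂ (le , sv) =
    let y , h , y∉ = #-avoid [] (*-cancelˡ-< 2 0 _ one)
        sy = not⁻ (proj₂ (∧⁻ {g x y} h))
    in x , y , sx , sy , proj₁ (∧⁻ h) , x∉ ∘ there , (λ e → x∉ (here e)) , λ e → clashᵇ sv (trans (cong side (sym e)) sy)
    where
    one : 0 < 2 * # (λ w → g x w ∧ not (side w))
    one = ≤-trans (s≤s z≤n) (lin {2} 0 (+-mono-≤ (cross-degree side x sx) le) (arith n (# side) (# (λ w → g x w ∧ not (side w)))))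
      where
      arith : ∀ n t c → 2 + (2 * t + 2 * c + n) + 0 ≡ 2 * c + (n + 2 + 2 * t)
      arith = solve-∀

  FreshCross : (Fin n → Bool) → List (Fin n) → Fin n → Set
  FreshCross side T v = ∃₂ λ x y → side x ≡ true × side y ≡ false × g x y ≡ true × (x ∉ T ⊎ y ∉ T) × x ≢ v × y ≢ v

  -- The smaller side sends an edge past any v; if the sides are equal, the side containing v does.
  fresh-cross : (∀ x y → g x y ≡ true → g y x ≡ true) → (side : Fin n → Bool) (T : List (Fin n)) →
    length T + 1 < # side → length T + 1 < # (not ∘ side) → ∀ v → FreshCross side T v
  fresh-cross sym-g side T room room' v = go (<-cmp (2 * # side) n)
    where
    from : Fresh side T v → FreshCross side T v
    from (x , y , sx , sy , e , x∉ , x≢v , y≢v) = x , y , sx , sy , e , inj₁ x∉ , x≢v , y≢v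

    from' : Fresh (not ∘ side) T v → FreshCross side T v
    from' (y , x , sy , sx , e , y∉ , y≢v , x≢v) =
      x , y , trans (sym (not-involutive (side x))) (cong not sx) , not⁻ sy , sym-g y x e , inj₂ y∉ , x≢v , y≢v

    other : 2 * # (not ∘ side) + 2 * # side ≡ n + n
    other = trans (arith (# side) (# (not ∘ side))) (cong₂ _+_ total total)
      where
      total : # side + # (not ∘ side) ≡ n
      total = trans (sym (#-split (λ _ → true) side)) (#-true n)
      arith : ∀ a b → 2 * b + 2 * a ≡ a + b + (a + b)
      arith = solve-∀

    go : Tri (2 * # side < n) (2 * # side ≡ n) (n < 2 * # side) → FreshCross side T v
    go (tri< lt _ _) = from (fresh side T room v (inj₁ lt))
    go (tri> _ _ gt) = from' (fresh (not ∘ side) T room' v (inj₁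
      (+-cancelʳ-< (2 * # side) (2 * # (not ∘ side)) n (subst (_< n + 2 * # side) (sym other) (+-monoʳ-< n gt)))))
    go (tri≈ _ eq _) with side v in sv
    ... | true  = from (fresh side T room v (inj₂ (≤-reflexive eq , sv)))
    ... | false = from' (fresh (not ∘ side) T room' v (inj₂ (≤-reflexive equal , cong not sv)))
      where
      equal : 2 * # (not ∘ side) ≡ n
      equal = +-cancelʳ-≡ (2 * # side) (2 * # (not ∘ side)) n (trans other (cong (n +_) (sym eq)))

module Construction {k p q s : ℕ} (N : Large n k p q s) (g : Graph n) (simple : IsSimple g) (half-degree : MinDegHalf g)
  (side A B : Fin n → Bool) (HA : Half p s g side A) (HB : Half p s g (not ∘ side) B)
  (zd : Graph n) (zd-cross : ∀ x y → zd x y ≡ true → cross-graph g side x y ≡ true)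
  (T₀ : List (Fin n)) (T₀-size : length T₀ ≤ 2 * k) (T₀-touched : ∀ x y → zd x y ≡ true → x ∈ T₀ × y ∈ T₀) where

  sym-g : ∀ x y → g x y ≡ true → g y x ≡ true
  sym-g x y h = trans (IsSimple.sym simple y x) h

  zs : Graph n
  zs x y = zd x y ∨ zd y x

  sym-z : ∀ x y → zs x y ≡ zs y x
  sym-z x y = ∨-comm (zd x y) (zd y x)

  z-cross : ∀ {x y} → side x ≡ side y → zs x y ≡ false
  z-cross {x} {y} eq = ¬-not λ h → absurd (∨⁻ h)
    where
    absurd : _ → ⊥
    absurd (inj₁ h) with cross-bipartite g side x y (zd-cross x y h)
    ... | a , b = clashᵇ a (trans eq b)
    absurd (inj₂ h) with cross-bipartite g side y x (zd-cross y x h)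
    ... | a , b = clashᵇ a (trans (sym eq) b)

  z-touched : ∀ x y → zs x y ≡ true → x ∈ T₀ × y ∈ T₀
  z-touched x y h with ∨⁻ {zd x y} h
  ... | inj₁ h' = T₀-touched x y h'
  ... | inj₂ h' = proj₂ (T₀-touched y x h') , proj₁ (T₀-touched y x h')

  -- T lists the vertices that r and zs touch across the two sides; a crossing edge leaving T is unused.
  record State (i : ℕ) : Set where
    field
      C        : Fin i → HamCycle g
      disjoint : ∀ a b → a ≢ b → ∀ x y → InCycle (C a) x y → ¬ InCycle (C b) x y
      r        : Graph n
      r-covers : ∀ a x y → InCycle (C a) x y → r x y ≡ true
      r-sym    : ∀ x y → r x y ≡ true → r y x ≡ true
      r-degree : ∀ x → # (r x) ≤ 2 * i
      r-z      : ∀ x y → zs x y ≡ true → r x y ≡ false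
      T        : List (Fin n)
      T-size   : length T ≤ 2 * k + 4 * i
      r-touched : ∀ x y → side x ≡ true → side y ≡ false → r x y ≡ true → x ∈ T × y ∈ T
      z-touched′ : ∀ x y → zs x y ≡ true → x ∈ T × y ∈ T

  initial : State 0
  initial = record
    { C = λ () ; disjoint = λ () ; r = λ _ _ → false ; r-covers = λ () ; r-sym = λ _ _ ()
    ; r-degree = λ x → ≤-reflexive (#-none {n} λ _ → refl) ; r-z = λ _ _ _ → refl
    ; T = T₀ ; T-size = ≤-trans T₀-size (m≤m+n _ _) ; r-touched = λ _ _ _ _ () ; z-touched′ = z-touched }

  3≤n : 1 ≤ q → 3 ≤ n
  3≤n 1≤q = lin (6 * s + 7) (+-mono-≤ large (+-mono-≤ (*-monoʳ-≤ 6 s<k) (+-mono-≤ (*-monoʳ-≤ 6 1≤p) (*-monoʳ-≤ 8 1≤q)))) (arith n k p q s)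
    where
    open Large N
    arith : ∀ n k p q s → 3 + (n + 10 + (6 * k + (6 * p + 8 * q))) + (6 * s + 7) ≡
      n + (6 * k + 6 * p + 8 * q + (6 * (1 + s) + (6 * 1 + 8 * 1)))
    arith = solve-∀

  module Step {i : ℕ} (i<q : i < q) (st : State i) where
    open State st

    e : Graph n
    e x y = g x y ∧ not (r x y ∨ zs x y)

    1≤q : 1 ≤ q
    1≤q = ≤-trans (s≤s z≤n) i<q

    room : ∀ {side core} → Half p s g side core → length T + 1 < # side
    room H = <-≤-trans (≤-<-trans (+-monoˡ-≤ 1 T-size) (HalfBounds.room H N i<q)) (#-⊆ (Half.core⊆side H))

    F : Fin n → Fin n → Set
    F x y = side x ≡ true × side y ≡ false × e x y ≡ true

    Avoids : Fin n → Set
    Avoids v = ∃₂ λ x y → F x y × x ≢ v × y ≢ v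

    unused : ∀ {v} → FreshCross (IsSimple.irrefl simple) half-degree side T v → Avoids v
    unused (x , y , sx , sy , gxy , new , x≢v , y≢v) =
      x , y , (sx , sy , ∧⁺ gxy (not⁺ (¬-not λ h → untouched new (touched (∨⁻ h))))) , x≢v , y≢v
      where
      touched : r x y ≡ true ⊎ zs x y ≡ true → x ∈ T × y ∈ T
      touched (inj₁ h) = r-touched x y sx sy h
      touched (inj₂ h) = z-touched′ x y h
      untouched : x ∉ T ⊎ y ∉ T → x ∈ T × y ∈ T → ⊥
      untouched (inj₁ x∉) (x∈ , _) = x∉ x∈
      untouched (inj₂ y∉) (_ , y∈) = y∉ y∈

    F-avoid : ∀ v → Avoids v
    F-avoid v = unused (fresh-cross (IsSimple.irrefl simple) half-degree sym-g side T (room HA) (room HB) v)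

    some-vertex : Fin n
    some-vertex = proj₁ (#-avoid [] (≤-trans (s≤s z≤n) (room HA)))

    module Cycle {a b a' b' : Fin n} (ab : F a b) (a'b' : F a' b') (a≢a' : a ≢ a') (b≢b' : b ≢ b') where

      tips : List (Fin n)
      tips = a ∷ a' ∷ b ∷ b' ∷ []

      same : Graph n
      same x y = does (side x ≟ᵇ side y)

      -- Across the cut only edges between the four tips are kept. Whatever Hamiltonian cycle of
      -- `e⁺` is found, it then adds nothing but the tips to the list `T`.
      e⁺ : Graph n
      e⁺ x y = e x y ∧ (same x y ∨ (mem tips x ∧ mem tips y))

      e-sym : ∀ x y → e x y ≡ true → e y x ≡ true
      e-sym x y h with ∧⁻ {g x y} h
      ... | gxy , h' = ∧⁺ (sym-g x y gxy) (not⁺ (¬-not λ h'' → flipped (∨⁻ {r y x} h'')))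
        where
        flipped : r y x ≡ true ⊎ zs y x ≡ true → ⊥
        flipped (inj₁ ryx) = clashᵇ (∨⁺ˡ (r-sym y x ryx)) (not⁻ h')
        flipped (inj₂ zyx) = clashᵇ (∨⁺ʳ {r x y} (trans (sym-z x y) zyx)) (not⁻ h')

      e⁺-sym : ∀ x y → e⁺ x y ≡ true → e⁺ y x ≡ true
      e⁺-sym x y h with ∧⁻ {e x y} h
      ... | exy , h' with ∨⁻ {same x y} h'
      ...   | inj₁ eq = ∧⁺ (e-sym x y exy) (∨⁺ˡ (dec-true (side y ≟ᵇ side x) (sym (holds (side x ≟ᵇ side y) eq))))
      ...   | inj₂ t  = ∧⁺ (e-sym x y exy) (∨⁺ʳ {same y x} (∧⁺ (proj₂ (∧⁻ {mem tips x} t)) (proj₁ (∧⁻ t))))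

      e⁺-e : ∀ x y → e⁺ x y ≡ true → e x y ≡ true
      e⁺-e x y h = proj₁ (∧⁻ h)

      e⁺-r : ∀ x y → e⁺ x y ≡ true → r x y ∨ zs x y ≡ false
      e⁺-r x y h = not⁻ (proj₂ (∧⁻ {g x y} (e⁺-e x y h)))

      e⁺-cross : ∀ x y → side x ≡ true → side y ≡ false → e⁺ x y ≡ true → x ∈ tips × y ∈ tips
      e⁺-cross x y sx sy h with ∨⁻ {same x y} (proj₂ (∧⁻ {e x y} h))
      ... | inj₁ eq = clashᵇ sx (trans (holds (side x ≟ᵇ side y) eq) sy)
      ... | inj₂ t with ∧⁻ {mem tips x} t
      ...   | tx , ty = holds (member? _≟_ x tips) tx , holds (member? _≟_ y tips) ty

      remains : ∀ v w → side v ≡ side w → g v w ≡ true → e⁺ v w ≡ true ⊎ r v w ≡ true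
      remains v w eq gvw with r v w
      ... | true  = inj₂ refl
      ... | false rewrite gvw | z-cross {v} {w} eq | dec-true (side v ≟ᵇ side w) eq = inj₁ refl

      tip-edge : ∀ {x y} → e x y ≡ true → x ∈ tips → y ∈ tips → e⁺ x y ≡ true
      tip-edge {x} {y} exy tx ty = ∧⁺ exy (∨⁺ʳ {same x y}
        (∧⁺ (dec-true (member? _≟_ x tips) tx) (dec-true (member? _≟_ y tips) ty)))

      SidePath : (Fin n → Bool) → Fin n → Fin n → Set
      SidePath side′ x y = ∃ λ l → Path (e⁺ ⇒ᵇ) (λ _ _ → ⊥) 0 x y l × l ↭ filterᵇ side′ (allFin n)

      sidePath : ∀ {side′ core} → Half p s g side′ core → (∀ v w → side′ v ≡ true → side′ w ≡ true → side v ≡ side w) →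
        ∀ {x y} → side′ x ≡ true → side′ y ≡ true → x ≢ y →
        SidePath side′ x y
      sidePath {side′} {core} H together = hamPath side′ core (Half.core⊆side H) e⁺ e⁺-sym
        (core-pair i<q) (λ u _ su cu _ → extra-pair i<q u su cu) (HalfBounds.core-double H N 1≤q)
        where open HalfBounds.Remaining H N e⁺ r i r-degree (λ v w sv sw → remains v w (together v w sv sw))

      HAsame : ∀ v w → side v ≡ true → side w ≡ true → side v ≡ side w
      HAsame v w sv sw = trans sv (sym sw)

      HBsame : ∀ v w → not (side v) ≡ true → not (side w) ≡ true → side v ≡ side w
      HBsame v w sv sw = trans (not⁻ sv) (sym (not⁻ sw))

      -- The cycle runs from `a` to `a'` in one side, over `a'b'`, from `b'` to `b` in the other
      -- side, and back over `ba`.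
      close : SidePath side a a' → SidePath (not ∘ side) b' b → HamCycle e⁺
      close (_ , P , π) (_ , Q , ρ) = closePath (3≤n 1≤q)
        (join-good P (tip-edge (proj₂ (proj₂ a'b')) (there (here refl)) (there (there (there (here refl))))) Q)
        (tip-edge (e-sym a b (proj₂ (proj₂ ab))) (there (there (here refl))) (here refl))
        (↭-trans (++⁺ π ρ) (filterᵇ-partition side (allFin n)))

      cycle : HamCycle e⁺
      cycle = close (sidePath HA HAsame (proj₁ ab) (proj₁ a'b') a≢a')
        (sidePath HB HBsame (not⁺ (proj₁ (proj₂ a'b'))) (not⁺ (proj₁ (proj₂ ab))) (b≢b' ∘ sym))

      module Extend (cycle : HamCycle e⁺) where

        D : HamCycle g
        D = mapEdges (λ x y h → proj₁ (∧⁻ {g x y} (e⁺-e x y h))) cycle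

        D-edge : ∀ {x y} → InCycle D x y → e⁺ x y ≡ true
        D-edge = inCycle⇒edge cycle e⁺-sym

        r′ : Graph n
        r′ x y = r x y ∨ does (inCycle? D x y)

        extended : State (suc i)
        extended = record
          { C = C′ ; disjoint = disjoint′ ; r = r′ ; r-covers = covers′ ; r-sym = sym′ ; r-degree = degree′
          ; r-z = r-z′ ; T = tips ++ T ; T-size = size′ ; r-touched = touched′
          ; z-touched′ = λ x y h → ∈-++⁺ʳ tips (proj₁ (z-touched′ x y h)) , ∈-++⁺ʳ tips (proj₂ (z-touched′ x y h)) }
          where
          C′ : Fin (suc i) → HamCycle g
          C′ zero    = D
          C′ (suc a) = C a

          clash : ∀ b {x y} → InCycle D x y → ¬ InCycle (C b) x y
          clash b {x} {y} d c = clashᵇ (∨⁺ˡ (r-covers b x y c)) (e⁺-r x y (D-edge d))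

          disjoint′ : ∀ a b → a ≢ b → ∀ x y → InCycle (C′ a) x y → ¬ InCycle (C′ b) x y
          disjoint′ zero    zero    a≢b x y = contradiction refl a≢b
          disjoint′ zero    (suc b) _   x y d c = clash b d c
          disjoint′ (suc a) zero    _   x y c d = clash a d c
          disjoint′ (suc a) (suc b) a≢b x y = disjoint a b (a≢b ∘ cong suc) x y

          covers′ : ∀ a x y → InCycle (C′ a) x y → r′ x y ≡ true
          covers′ zero    x y d = ∨⁺ʳ {r x y} (dec-true (inCycle? D x y) d)
          covers′ (suc a) x y c = ∨⁺ˡ (r-covers a x y c)

          sym′ : ∀ x y → r′ x y ≡ true → r′ y x ≡ true
          sym′ x y h with ∨⁻ {r x y} h
          ... | inj₁ h' = ∨⁺ˡ (r-sym x y h')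
          ... | inj₂ h' = ∨⁺ʳ {r y x} (dec-true (inCycle? D y x) (inCycle-sym D (holds (inCycle? D x y) h')))

          degree′ : ∀ x → # (r′ x) ≤ 2 * suc i
          degree′ x = ≤-trans (#-∨ (r x) _) (≤-trans (+-mono-≤ (r-degree x) (cycle-degree D x)) (≤-reflexive (arith i)))
            where
            arith : ∀ i → 2 * i + 2 ≡ 2 * (1 + i)
            arith = solve-∀

          r-z′ : ∀ x y → zs x y ≡ true → r′ x y ≡ false
          r-z′ x y zxy rewrite r-z x y zxy = dec-false (inCycle? D x y)
            λ d → clashᵇ (∨⁺ʳ {r x y} zxy) (e⁺-r x y (D-edge d))

          size′ : length (tips ++ T) ≤ 2 * k + 4 * suc i
          size′ = ≤-trans (+-monoʳ-≤ 4 T-size) (≤-reflexive (arith k i))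
            where
            arith : ∀ k i → 4 + (2 * k + 4 * i) ≡ 2 * k + 4 * (1 + i)
            arith = solve-∀

          touched′ : ∀ x y → side x ≡ true → side y ≡ false → r′ x y ≡ true → x ∈ tips ++ T × y ∈ tips ++ T
          touched′ x y sx sy h with ∨⁻ {r x y} h
          ... | inj₁ h' = ∈-++⁺ʳ tips (proj₁ (r-touched x y sx sy h')) , ∈-++⁺ʳ tips (proj₂ (r-touched x y sx sy h'))
          ... | inj₂ h' with e⁺-cross x y sx sy (D-edge (holds (inCycle? D x y) h'))
          ...   | x∈ , y∈ = ∈-++⁺ˡ x∈ , ∈-++⁺ˡ y∈

      next-state : State (suc i)
      next-state = Extend.extended cycle

    DisjointPair : Set
    DisjointPair = ∃₂ λ a b → ∃₂ λ a' b' → F a b × F a' b' × a ≢ a' × b ≢ b'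

    extend : DisjointPair → State (suc i)
    extend (a , b , a' , b' , ab , a'b' , a≢a' , b≢b') = Cycle.next-state ab a'b' a≢a' b≢b'

    advance : State (suc i)
    advance = extend (two-disjoint side F (λ (sx , sy , _) → sx , sy) F-avoid some-vertex)

  states : ∀ i → i ≤ q → State i
  states zero    _   = initial
  states (suc i) i<q = Step.advance i<q (states i (<⇒≤ i<q))

-- Connectivity of what remains

module _ {R : Fin n → Fin n → Set} {S : Subset n} where

  infixr 5 _++ʷ_
  _++ʷ_ : ∀ {u v w} → Walk R S u v → Walk R S v w → Walk R S u w
  here ++ʷ Q = Q
  step e w∉ P ++ʷ Q = step e w∉ (P ++ʷ Q)

  -- A `Walk` is kept out of `S` only at the vertices it enters. Its start becomes an entered vertex
  -- on reversal and therefore has to be known to lie outside `S`.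
  reverseWalk : (∀ {x y} → R x y → R y x) → ∀ {u v} → u Subset.∉ S → Walk R S u v → Walk R S v u
  reverseWalk sym-R u∉ here = here
  reverseWalk sym-R u∉ (step e w∉ P) = reverseWalk sym-R w∉ P ++ʷ step (sym-R e) u∉ here

  mapWalk : {R' : Fin n → Fin n → Set} → (∀ {x y} → R x y → R' x y) → ∀ {u v} → Walk R S u v → Walk R' S u v
  mapWalk h here = here
  mapWalk h (step e w∉ P) = step (h e) w∉ (mapWalk h P)

module HalfConnected {p s k q : ℕ} {g : Graph n} {side core : Fin n → Bool} (H : Half p s g side core) (N : Large n k p q s)
  (f r : Graph n) (sym-f : ∀ x y → f x y ≡ true → f y x ≡ true) (irr : ∀ x → f x x ≡ false)
  (r-degree : ∀ x → # (r x) ≤ 2 * q) (remains : ∀ x y → g x y ≡ true → f x y ≡ true ⊎ r x y ≡ true)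
  (S : Subset n) (S<k : ∣ S ∣ < k) where

  open HalfBounds.Remaining H N f r q r-degree (λ v w _ _ → remains v w)

  #S<k : # (lookup S) < k
  #S<k = subst (_< k) (∣∣≡# S) S<k

  W : Fin n → Fin n → Set
  W = Walk (f ⇒ᵇ) S

  -- Walks in a side go through its core: core vertices are adjacent or have k common neighbours
  -- there, and every other vertex of the side has k neighbours there. `S` is too small to contain
  -- them all.
  core-walk : ∀ u v → core u ≡ true → core v ≡ true → v Subset.∉ S → W u v
  core-walk u v cu cv v∉ with u ≟ v
  ... | yes refl = here
  ... | no u≢v with f u v in fuv
  ...   | true  = step fuv v∉ here
  ...   | false with #-witness (<-≤-trans #S<k (common refl u v u≢v cu cv irr fuv (¬-not λ fvu → clashᵇ (sym-f v u fvu) fuv)))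
  ...     | w , h , w∉ with ∧⁻ {f u w ∧ core w} h
  ...       | h₁ , h₂ = step (proj₁ (∧⁻ h₁)) (lookup⇒∉ w∉) (step (sym-f v w (proj₁ (∧⁻ h₂))) v∉ here)

  hub : ∀ u → side u ≡ true → u Subset.∉ S → ∃ λ a → core a ≡ true × a Subset.∉ S × W u a
  hub u su u∉ with core u in cu
  ... | true  = u , cu , u∉ , here
  ... | false with #-witness (<-≤-trans #S<k (extra-hub refl u su cu))
  ...   | w , h , w∉ = w , proj₂ (∧⁻ {f u w} h) , lookup⇒∉ w∉ , step (proj₁ (∧⁻ h)) (lookup⇒∉ w∉) here

  side-walk : ∀ u v → side u ≡ true → side v ≡ true → u Subset.∉ S → v Subset.∉ S → W u v
  side-walk u v su sv u∉ v∉ with hub u su u∉ | hub v sv v∉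
  ... | a , ca , a∉ , P | b , cb , b∉ , Q =
    P ++ʷ core-walk a b ca cb b∉ ++ʷ reverseWalk (λ {x} {y} → sym-f x y) v∉ Q

-- Separations and the failure of property (i)

record Separation (p k : ℕ) (g : Graph n) (A B : Fin n → Bool) : Set where
  field
    disjoint : ∀ v → A v ≡ true → B v ≡ false
    few      : # (outside A B) < k
    sparseA  : ∀ v → A v ≡ true → # (λ w → g v w ∧ B w) ≤ p
    sparseB  : ∀ v → B v ≡ true → # (λ w → g v w ∧ A w) ≤ p
    inA      : ∃ λ v → A v ≡ true
    inB      : ∃ λ v → B v ≡ true

separation? : ∀ p k (g : Graph n) A B → Dec (Separation p k g A B)
separation? p k g A B
  with all? (λ v → (A v ≟ᵇ true) →-dec (B v ≟ᵇ false)) | # (outside A B) <? k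
     | all? (λ v → (A v ≟ᵇ true) →-dec (# (λ w → g v w ∧ B w) ≤? p))
     | all? (λ v → (B v ≟ᵇ true) →-dec (# (λ w → g v w ∧ A w) ≤? p))
     | any? (λ v → A v ≟ᵇ true) | any? (λ v → B v ≟ᵇ true)
... | yes a | yes b | yes c | yes d | yes e | yes f = yes (record
  { disjoint = a ; few = b ; sparseA = c ; sparseB = d ; inA = e ; inB = f })
... | no ¬a | _ | _ | _ | _ | _ = no (¬a ∘ Separation.disjoint)
... | _ | no ¬a | _ | _ | _ | _ = no (¬a ∘ Separation.few)
... | _ | _ | no ¬a | _ | _ | _ = no (¬a ∘ Separation.sparseA)
... | _ | _ | _ | no ¬a | _ | _ = no (¬a ∘ Separation.sparseB)
... | _ | _ | _ | _ | no ¬a | _ = no (¬a ∘ Separation.inA)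
... | _ | _ | _ | _ | _ | no ¬a = no (¬a ∘ Separation.inB)

-- What a violating subgraph leaves behind, stated in `g` alone. With subsets in place of subgraphs
-- the search is finite, and the main case distinction is constructive.
Separable : ℕ → ℕ → Graph n → Set
Separable {n} p k g = ∃₂ λ (A B : Subset n) → Separation p k g (lookup A) (lookup B)

separable? : ∀ p k (g : Graph n) → Dec (Separable p k g)
separable? p k g = anySubset? λ A → anySubset? λ B → separation? p k g (lookup A) (lookup B)

Closed : (R : Fin n → Fin n → Set) (S : Subset n) → (Fin n → Bool) → Set
Closed R S A = ∀ x y → A x ≡ true → A y ≡ false → y Subset.∉ S → ¬ R x y

reachable : (R : Fin n → Fin n → Set) → (∀ x y → Dec (R x y)) → (S : Subset n) → ∀ u → u Subset.∉ S →
  ∃ λ A → A u ≡ true × (∀ x → A x ≡ true → Walk R S u x × x Subset.∉ S) × Closed R S A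
reachable {n} R R? S u u∉ = grow n (u =ᵇ_) (m≤n+m n _) (dec-true (u ≟ u) refl)
  (λ x h → subst (λ x → Walk R S u x × x Subset.∉ S) (holds (u ≟ x) h) (here , u∉))
  where
  Reached : (Fin n → Bool) → Set
  Reached A = ∀ x → A x ≡ true → Walk R S u x × x Subset.∉ S

  -- `m` bounds the number of vertices still missing from `A`, so at 0 none is left to be added.
  grow : ∀ m A → n ≤ # A + m → A u ≡ true → Reached A → ∃ λ A → A u ≡ true × Reached A × Closed R S A
  grow m A size Au reached
    with any? (λ x → any? λ y → (A x ≟ᵇ true) ×-dec ((A y ≟ᵇ false) ×-dec ((lookup S y ≟ᵇ false) ×-dec R? x y)))
  ... | no none = A , Au , reached , λ x y ax ay y∉ e → none (x , y , ax , ay , ∉⇒lookup y∉ , e)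
  grow zero A size Au reached | yes (x , y , ax , ay , y∉ , e) =
    contradiction (≤-trans (+-monoˡ-≤ 1 size) (≤-trans (≤-reflexive (cong (_+ 1) (+-identityʳ (# A))))
      (≤-trans (#-⊂ {f = λ _ → true} {A} {y} (λ _ _ → refl) refl ay) (≤-reflexive (#-true n)))))
      (<⇒≱ (≤-reflexive (+-comm 1 n)))
  grow (suc m) A size Au reached | yes (x , y , ax , ay , y∉ , e) =
    grow m A⁺ (≤-trans size (≤-trans (≤-reflexive (sym (+-assoc (# A) 1 m))) (+-monoˡ-≤ m bigger))) (∨⁺ˡ Au) reached⁺
    where
    A⁺ : Fin n → Bool
    A⁺ w = A w ∨ (y =ᵇ w)
    bigger : # A + 1 ≤ # A⁺
    bigger = #-⊂ {f = A⁺} {A} {y} (λ _ → ∨⁺ˡ) (∨⁺ʳ {A y} (dec-true (y ≟ y) refl)) ay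
    reached⁺ : Reached A⁺
    reached⁺ w h with ∨⁻ {A w} h
    ... | inj₁ aw = reached w aw
    ... | inj₂ eq with holds (y ≟ w) eq
    ...   | refl = proj₁ (reached x ax) ++ʷ step e (lookup⇒∉ y∉) here , lookup⇒∉ y∉

-- If `v` is not reached from `u`, the reached set and the remaining vertices outside `S` form a
-- separation: every edge of `g` between them lies in `h`, whose degrees are at most `p`.
inseparable⇒connected : ∀ {p} {g : Graph n} → IsSimple g → k < n → ¬ Separable p k g →
  ∀ h → SpanningSubgraph g h → MaxDegAtMost h p → KConnected k (minusEdges g h)
inseparable⇒connected {n} {k} {p} {g} simple k<n ¬sep h sub Δ≤p = k<n , connected
  where
  sym-h : ∀ x y → h x y ≡ h y x
  sym-h = IsSimple.sym (SpanningSubgraph.simple sub)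

  connected : ∀ S → ∣ S ∣ < k → ∀ u v → u Subset.∉ S → v Subset.∉ S → Walk (minusEdges g h) S u v
  connected S lt u v u∉ v∉
    with reachable (minusEdges g h) (λ x y → (g x y ≟ᵇ true) ×-dec (h x y ≟ᵇ false)) S u u∉
  ... | A , Au , reached , closed with A v in av
  ...   | true  = proj₁ (reached v av)
  ...   | false = contradiction (vtabulate A , vtabulate B , separation) ¬sep
    where
    B : Fin n → Bool
    B w = not (A w) ∧ not (lookup S w)
    A≡ = lookup∘tabulate A
    B≡ = lookup∘tabulate B

    B⁻ : ∀ {w} → B w ≡ true → A w ≡ false × w Subset.∉ S
    B⁻ {w} bw = not⁻ (proj₁ (∧⁻ bw)) , lookup⇒∉ (not⁻ (proj₂ (∧⁻ {not (A w)} bw)))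

    in-h : ∀ {x y} → A x ≡ true → B y ≡ true → g x y ≡ true → h x y ≡ true
    in-h {x} {y} ax by gxy with h x y in hxy
    ... | true  = refl
    ... | false = contradiction (gxy , hxy) (closed x y ax (proj₁ (B⁻ by)) (proj₂ (B⁻ by)))

    by-degree : ∀ v (X : Fin n → Bool) → (∀ w → g v w ≡ true → X w ≡ true → h v w ≡ true) → # (λ w → g v w ∧ X w) ≤ p
    by-degree v X sub' = ≤-trans (#-⊆ λ w e → sub' w (proj₁ (∧⁻ e)) (proj₂ (∧⁻ {g v w} e)))
      (≤-trans (≤-reflexive (sym (deg≡# h v))) (Δ≤p v))

    separation : Separation p k g (lookup (vtabulate A)) (lookup (vtabulate B))
    separation = record
      { disjoint = λ w aw → trans (B≡ w) (cong (λ b → not b ∧ not (lookup S w)) (trans (sym (A≡ w)) aw))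
      ; few = ≤-<-trans (#-⊆ out) (subst (_< k) (∣∣≡# S) lt)
      ; sparseA = λ x ax → by-degree x _ λ y gxy by → in-h (trans (sym (A≡ x)) ax) (trans (sym (B≡ y)) by) gxy
      ; sparseB = λ y by → by-degree y _ λ x gyx ax → trans (sym-h y x)
          (in-h (trans (sym (A≡ x)) ax) (trans (sym (B≡ y)) by) (trans (IsSimple.sym simple x y) gyx))
      ; inA = u , trans (A≡ u) Au
      ; inB = v , trans (B≡ v) (∧⁺ (not⁺ av) (not⁺ (∉⇒lookup v∉)))
      }
      where
      out : ∀ w → outside (lookup (vtabulate A)) (lookup (vtabulate B)) w ≡ true → lookup S w ≡ true
      out w o rewrite A≡ w | B≡ w with A w | lookup S w
      ... | false | true  = refl
      ... | false | false = o
      ... | true  | true  = refl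

-- Property (ii) from a separation

module Halves {k p q s : ℕ} (1≤q : 1 ≤ q) (N : Large n k p q s) (g : Graph n) (simple : IsSimple g)
  (half-degree : MinDegHalf g) (conn : KConnected k (Edge g))
  (side A B : Fin n → Bool) (HA : Half p s g side A) (HB : Half p s g (not ∘ side) B) where

  open IsSimple simple

  big : ∀ {side core} → Half p s g side core → k ≤ # side
  big H = ≤-trans (≤-trans (m≤n*m k 2) (≤-trans (m≤m+n (2 * k) _) (≤-trans (m≤m+n _ 1) (<⇒≤ (HalfBounds.room H N {0} 1≤q)))))
    (#-⊆ (Half.core⊆side H))

  Conclusion : Set
  Conclusion = Σ (Fin q → HamCycle g) λ C →
    (∀ a b → a ≢ b → ∀ x y → InCycle (C a) x y → ¬ InCycle (C b) x y) × KConnected k (minusCycles C)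

  module FromKernel (zd : Graph n) (zd⊆ : ∀ x y → zd x y ≡ true → cross-graph g side x y ≡ true)
    (¬cov : ¬ Covered k zd) (T₀ : List (Fin n)) (T₀-size : length T₀ ≤ 2 * k)
    (T₀-touched : ∀ x y → zd x y ≡ true → x ∈ T₀ × y ∈ T₀) where

    open Construction N g simple half-degree side A B HA HB zd zd⊆ T₀ T₀-size T₀-touched

    module FromState (st : State q) where
      open State st using (C; r; r-covers; r-sym; r-degree; r-z)

      f : Graph n
      f x y = g x y ∧ not (r x y)

      sym-f : ∀ x y → f x y ≡ true → f y x ≡ true
      sym-f x y h with ∧⁻ {g x y} h
      ... | gxy , nr = ∧⁺ (sym-g x y gxy) (not⁺ (¬-not λ ryx → clashᵇ (r-sym y x ryx) (not⁻ nr)))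

      irr : ∀ x → f x x ≡ false
      irr x rewrite irrefl x = refl

      remains : ∀ x y → g x y ≡ true → f x y ≡ true ⊎ r x y ≡ true
      remains x y gxy with r x y
      ... | true  = inj₂ refl
      ... | false rewrite gxy = inj₁ refl

      f⇒minus : ∀ {x y} → f x y ≡ true → minusCycles C x y
      f⇒minus {x} {y} h with ∧⁻ {g x y} h
      ... | gxy , nr = gxy , λ a c → clashᵇ (r-covers a x y c) (not⁻ nr)

      connected : ∀ S → ∣ S ∣ < k → ∀ u v → u Subset.∉ S → v Subset.∉ S → Walk (minusCycles C) S u v
      connected S lt u v u∉ v∉ = mapWalk f⇒minus (walk u v u∉ v∉)
        where
        module CA = HalfConnected HA N f r sym-f irr r-degree remains S lt
        module CB = HalfConnected HB N f r sym-f irr r-degree remains S lt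

        -- `S` has fewer than k vertices and so does not cover the reserved graph. An edge that it
        -- misses is in no cycle, by `r-z`, and links the two connected sides.
        across : ∀ u v → side u ≡ true → side v ≡ false → u Subset.∉ S → v Subset.∉ S → Walk (f ⇒ᵇ) S u v
        across u v su sv u∉ v∉ with ¬Covered⇒Missed zd ¬cov (lookup S) CA.#S<k
        ... | x , y , e , x∉ , y∉ with cross-bipartite g side x y (zd⊆ x y e)
        ...   | sx , sy = CA.side-walk u x su sx u∉ (lookup⇒∉ x∉)
          ++ʷ step (∧⁺ (proj₁ (∧⁻ (zd⊆ x y e))) (not⁺ (r-z x y (∨⁺ˡ e)))) (lookup⇒∉ y∉)
            (CB.side-walk y v (not⁺ sy) (not⁺ sv) (lookup⇒∉ y∉) v∉)

        walk : ∀ u v → u Subset.∉ S → v Subset.∉ S → Walk (f ⇒ᵇ) S u v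
        walk u v u∉ v∉ with side u in su | side v in sv
        ... | true  | true  = CA.side-walk u v su sv u∉ v∉
        ... | false | false = CB.side-walk u v (not⁺ su) (not⁺ sv) u∉ v∉
        ... | true  | false = across u v su sv u∉ v∉
        ... | false | true  = reverseWalk (λ {x} {y} → sym-f x y) v∉ (across v u sv su v∉ u∉)

    conclude : State q → Conclusion
    conclude st = State.C st , State.disjoint st , proj₁ conn , FromState.connected st

    conclusion : Conclusion
    conclusion = conclude (states q ≤-refl)

  Kernel : Set
  Kernel = ∃ λ z → (∀ x y → z x y ≡ true → cross-graph g side x y ≡ true) × ¬ Covered k z ×
    ∃ λ T → length T ≤ 2 * k × (∀ x y → z x y ≡ true → x ∈ T × y ∈ T)

  from-kernel : Kernel → Conclusion
  from-kernel (zd , zd⊆ , ¬cov , T₀ , size , touched) = FromKernel.conclusion zd zd⊆ ¬cov T₀ size touched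

  conclusion : Conclusion
  conclusion = from-kernel
    (kernel side (cross-graph g side) (cross-bipartite g side) (cross-uncovered conn (big HA) (big HB)))

module Separated {k p q : ℕ} (1≤p : 1 ≤ p) (1≤q : 1 ≤ q) (large : 6 * k + 6 * p + 8 * q ≤ n + 10)
  (g : Graph n) (simple : IsSimple g) (half-degree : MinDegHalf g) (conn : KConnected k (Edge g))
  (A B : Fin n → Bool) (sep : Separation p k g A B) where

  open Separation sep
  open IsSimple simple

  s : ℕ
  s = # (outside A B)

  N : Large n k p q s
  N = record { large = large ; s<k = few ; 1≤p = 1≤p }

  dA dB : Fin n → ℕ
  dA v = # (λ w → g v w ∧ A w)
  dB v = # (λ w → g v w ∧ B w)

  side : Fin n → Bool
  side v = A v ∨ (not (B v) ∧ does (dB v ≤? dA v))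

  B⇒¬A : ∀ v → B v ≡ true → A v ≡ false
  B⇒¬A v bv = ¬-not λ av → clashᵇ bv (disjoint v av)

  outside-comm : # (outside B A) ≡ s
  outside-comm = ≤-antisym (#-⊆ λ w → trans (comm (A w) (B w))) (#-⊆ λ w → trans (comm (B w) (A w)))
    where
    comm : ∀ a b → not (a ∨ b) ≡ not (b ∨ a)
    comm true  true  = refl
    comm true  false = refl
    comm false true  = refl
    comm false false = refl

  HA : Half p s g side A
  HA = half g irrefl half-degree p side A B refl (λ _ → ∨⁺ˡ) extra disjoint sparseA inA
    (subst (λ s → n + 2 ≤ 2 * # B + 2 * s + 2 * p) outside-comm
      (core-size g irrefl half-degree p B A _ (proj₂ inB) (sparseB _ (proj₂ inB))))
    where
    extra : ∀ v → side v ≡ true → A v ≡ false → B v ≡ false × dB v ≤ dA v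
    extra v sv av rewrite av with ∧⁻ {not (B v)} sv
    ... | bv , le = not⁻ bv , holds (dB v ≤? dA v) le

  HB : Half p s g (not ∘ side) B
  HB = half g irrefl half-degree p (not ∘ side) B A outside-comm B⊆ extra B⇒¬A sparseB inB
    (core-size g irrefl half-degree p A B _ (proj₂ inA) (sparseA _ (proj₂ inA)))
    where
    B⊆ : ∀ v → B v ≡ true → not (side v) ≡ true
    B⊆ v bv rewrite bv | B⇒¬A v bv = refl
    extra : ∀ v → not (side v) ≡ true → B v ≡ false → A v ≡ false × dA v ≤ dB v
    extra v sv bv with A v
    ... | true  = contradiction sv λ ()
    ... | false rewrite bv = refl , <⇒≤ (≰⇒> (fails (dB v ≤? dA v) (not⁻ sv)))

  conclusion : Σ (Fin q → HamCycle g) λ C →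
    (∀ a b → a ≢ b → ∀ x y → InCycle (C a) x y → ¬ InCycle (C b) x y) × KConnected k (minusCycles C)
  conclusion = Halves.conclusion 1≤q N g simple half-degree conn side A B HA HB

-- Since (k - 2)/k is less than 1, the ceiling is at most 1. The constant 10 is the 8 from q - 1
-- plus twice this ceiling; moving it to the right avoids truncated subtraction.
bound⇒large : ∀ k p q → 2 ≤ k → 1 ≤ q → bound k p q ≤ n → 6 * k + 6 * p + 8 * q ≤ n + 10
bound⇒large (suc zero) p q (s≤s ()) _ _
bound⇒large {n} (suc (suc k)) p (suc q) _ _ le = lin 0 (+-mono-≤ main (*-monoʳ-≤ 2 ceil≤1))
  (arith n (2 + k) p q (ceilDivSuc k (suc k)))
  where
  ceil≤1 : ceilDivSuc k (suc k) ≤ 1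
  ceil≤1 = s≤s⁻¹ (m<n*o⇒m/o<n {k + suc k} {2} {2 + k} (lin 2 (≤-refl {0}) (arith′ k)))
    where
    arith′ : ∀ k → 1 + (k + (1 + k)) + 0 + 2 ≡ 2 * (2 + k) + 0
    arith′ = solve-∀
  main : 6 * (2 + k + p) + 8 * q ≤ 2 * ceilDivSuc k (suc k) + n
  main = ≤-trans (m≤n+m∸n _ (2 * ceilDivSuc k (suc k))) (+-monoʳ-≤ (2 * ceilDivSuc k (suc k)) (≤-trans (m≤m⊔n _ _) le))
  arith : ∀ n k p q c → 6 * k + 6 * p + 8 * (1 + q) + (2 * c + n + 2 * 1) + 0 ≡ n + 10 + (6 * (k + p) + 8 * q + 2 * c)
  arith = solve-∀

theorem12 : (k p q n : ℕ) → 2 ≤ k → 1 ≤ p → 1 ≤ q →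
    (g : Graph n) → IsSimple g → KConnected k (Edge g) →
    bound k p q ≤ n → MinDegHalf g →
    (∀ (h : Graph n) → SpanningSubgraph g h → MaxDegAtMost h p → KConnected k (minusEdges g h))
    ⊎
    (Σ (Fin q → HamCycle g) λ C →
    (∀ a b → a ≢ b → ∀ x y → InCycle (C a) x y → ¬ InCycle (C b) x y)
    × KConnected k (minusCycles C))
theorem12 k p q n 2≤k 1≤p 1≤q g simple conn bound≤n half-degree =
  [ inj₂ ∘ separated , inj₁ ∘ inseparable⇒connected simple (proj₁ conn) ]′ (toSum (separable? p k g))
  where
  separated : Separable p k g → _
  separated (A , B , sep) = Separated.conclusion 1≤p 1≤q (bound⇒large k p q 2≤k 1≤q bound≤n)
    g simple half-degree conn (lookup A) (lookup B) sep
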